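{- Let $n = p_1^{m_1} \cdots p_r^{m_r}$, where $p_1,\ldots,p_r$ are distinct primes and $m_1,\ldots,m_r$ are positive integers. Then the cyclotomic matroid $\mu_n$ is dual (orthogonal) to the direct sum of $p_1^{m_1-1} \cdots p_r^{m_r-1}$ copies of the simplicial matroid $\mathcal{S}(\Delta^{r-1}_{p_1,\ldots,p_r},\mathbb{Q})$.
   Context: Let $\zeta$ be a primitive $n$-th root of unity. The cyclotomic matroid $\mu_n$ is the matroid on the $n$-element ground set $Z_n=\{1,\zeta,\zeta^2,\ldots,\zeta^{n-1}\}$ represented over $\mathbb{Q}$ by these elements viewed as vectors in the $\mathbb{Q}$-vector space $\mathbb{Q}(\zeta)$ (so a subset is independent iff it is $\mathbb{Q}$-linearly independent); it has rank $\phi(n)$. For positive integers $n_1,\dots,n_r$, let $\Delta^0_{n_i}$ be the $0$-dimensional complex consisting of $n_i$ disjoint vertices, and let $\Delta^{r-1}_{n_1,\ldots,n_r}=\Delta^0_{n_1}*\cdots*\Delta^0_{n_r}$ be their simplicial join: its faces are the vertex sets containing at most one vertex from each $\Delta^0_{n_i}$, so its facets are the $(r-1)$-simplices with exactly one vertex from each $\Delta^0_{n_i}$. For a $d$-dimensional simplicial complex $\Delta$, the simplicial matroid $\mathcal{S}(\Delta,\mathbb{Q})$ is the matroid on the set of $d$-dimensional faces (facets) of $\Delta$ represented over $\mathbb{Q}$ by the columns of the matrix of the boundary map $\partial_d:\tilde C_d(\Delta,\mathbb{Q})\to\tilde C_{d-1}(\Delta,\mathbb{Q})$ of the augmented (reduced)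 simplicial chain complex (for $d=0$, $\tilde C_{ -1}=\mathbb{Q}$ and $\partial_0$ is the augmentation). The dual of a matroid $M$ on $E$ is the matroid on $E$ whose bases are the complements of the bases of $M$; "dual" here means isomorphic to the dual under some bijection of ground sets. -}

module Defs where

open import Level using (Level; _⊔_; 0ℓ)
open import Data.Nat as ℕ using (ℕ; zero; suc; _<_; _≤_; _∸_)
open import Data.Nat.Primality using (Prime)
open import Data.Fin using (Fin; zero; suc)
import Data.Fin
import Relation.Nullary
open import Data.Vec using (Vec; []; _∷_; lookup)
open import Data.List using (List; []; _∷_; _++_; map; concatMap; allFin)
open import Data.Product using (Σ; _×_; _,_; ∃)
open import Data.Unit using (⊤; tt)
open import Data.Bool using (Bool; true; false; not; _∧_; if_then_else_)
open import Data.Rational as ℚ using (ℚ; 0ℚ; 1ℚ; -_)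
open import Data.Rational.Properties using (+-*-commutativeRing)
open import Relation.Nullary using (¬_; does)
open import Relation.Binary.PropositionalEquality using (_≡_)
open import Algebra.Bundles using (CommutativeRing; RawRing)
open import Algebra.Morphism.Structures using (module RingMorphisms)
open import Function.Bundles using (_↔_; Inverse; _⇔_)

prodℕ : ∀ {r} → Vec ℕ r → ℕ
prodℕ []       = 1
prodℕ (x ∷ xs) = x ℕ.* prodℕ xs

powVec : ∀ {r} → Vec ℕ r → Vec ℕ r → Vec ℕ r
powVec []       []       = []
powVec (p ∷ ps) (m ∷ ms) = (p ℕ.^ m) ∷ powVec ps ms

powVecPred : ∀ {r} → Vec ℕ r → Vec ℕ r → Vec ℕ r
powVecPred []       []       = []
powVecPred (p ∷ ps) (m ∷ ms) = (p ℕ.^ (m ∸ 1)) ∷ powVecPred ps ms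

record Field (c ℓ : Level) : Set (Level.suc (c ⊔ ℓ)) where
  field
    commutativeRing : CommutativeRing c ℓ
  open CommutativeRing commutativeRing public
  field
    1≉0     : ¬ (1# ≈ 0#)
    inverse : ∀ x → ¬ (x ≈ 0#) → ∃ λ y → (x * y) ≈ 1#

ℚ-rawRing : RawRing 0ℓ 0ℓ
ℚ-rawRing = CommutativeRing.rawRing +-*-commutativeRing

-- A field of characteristic 0, i.e. a field K together with a ring
-- homomorphism ι : ℚ → K (making K a ℚ-vector space).
record ℚField (c ℓ : Level) : Set (Level.suc (c ⊔ ℓ)) where
  field
    field' : Field c ℓ
  open Field field' public
  field
    ι      : ℚ → Carrier
    ι-hom  : RingMorphisms.IsRingHomomorphism ℚ-rawRing rawRing ι

module _ {c ℓ} (K : ℚField c ℓ) where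
  open ℚField K using (Carrier; _≈_; _+_; _*_; 0#; 1#; ι)

  pow : Carrier → ℕ → Carrier
  pow x zero    = 1#
  pow x (suc k) = x * pow x k

  sumFin : ∀ n → (Fin n → Carrier) → Carrier
  sumFin zero    f = 0#
  sumFin (suc n) f = f zero + sumFin n (λ k → f (suc k))

  IsPrimitiveRoot : ℕ → Carrier → Set ℓ
  IsPrimitiveRoot n ζ = (pow ζ n ≈ 1#) × (∀ k → 0 < k → k < n → ¬ (pow ζ k ≈ 1#))

  CycIndep : (n : ℕ) → Carrier → (Fin n → Bool) → Set ℓ
  CycIndep n ζ S =
    (c : Fin n → ℚ) →
    (∀ k → S k ≡ false → c k ≡ 0ℚ) →
    sumFin n (λ k → ι (c k) * pow ζ (Data.Fin.toℕ k)) ≈ 0# →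
    ∀ k → c k ≡ 0ℚ

IsBasis : ∀ {a ℓ} {E : Set a} → ((E → Bool) → Set ℓ) → (E → Bool) → Set (a ⊔ ℓ)
IsBasis {E = E} Ind B =
  Ind B × (∀ B' → Ind B' → (∀ e → B e ≡ true → B' e ≡ true) → ∀ e → B' e ≡ true → B e ≡ true)

-- The complex Δ^{r-1}_{p_1,…,p_r} = Δ⁰_{p_1} * ⋯ * Δ⁰_{p_r}.
-- The vertices of Δ⁰_{p_i} are Fin p_i.  A facet is a choice of one
-- vertex from each Δ⁰_{p_i}, i.e. an element of Fin p_1 × ⋯ × Fin p_r;
-- its vertices are ordered by the index i of the part they come from.

Facet : ∀ {r} → Vec ℕ r → Set
Facet []       = ⊤
Facet (p ∷ ps) = Fin p × Facet ps

allFacets : ∀ {r} (ps : Vec ℕ r) → List (Facet ps)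
allFacets []       = tt ∷ []
allFacets (p ∷ ps) = concatMap (λ a → map (λ f → (a , f)) (allFacets ps)) (allFin p)

-- A (r-2)-dimensional face of the join: obtained from a facet w by
-- deleting its i-th vertex; represented (redundantly) by the pair (i , w)
-- (the i-th entry of w is irrelevant).  For r = 1 this is the empty
-- face, the unique basis element of C̃_{-1} = ℚ.
Ridge : ∀ {r} → Vec ℕ r → Set
Ridge {r} ps = Fin r × Facet ps

agreeAll : ∀ {r} {ps : Vec ℕ r} → Facet ps → Facet ps → Bool
agreeAll {ps = []}     _       _       = true
agreeAll {ps = p ∷ ps} (a , f) (b , w) = does (a Data.Fin.≟ b) ∧ agreeAll f w

agreeOff : ∀ {r} {ps : Vec ℕ r} → Facet ps → Facet ps → Fin r → Bool
agreeOff {ps = p ∷ ps} (a , f) (b , w) zero    = agreeAll f w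
agreeOff {ps = p ∷ ps} (a , f) (b , w) (suc i) = does (a Data.Fin.≟ b) ∧ agreeOff f w i

sign : ℕ → ℚ
sign zero    = 1ℚ
sign (suc i) = - sign i

-- The column of the boundary matrix ∂_{r-1} indexed by the facet f:
--   ∂ [v_0,…,v_{r-1}] = Σ_i (-1)^i [v_0,…,v̂_i,…,v_{r-1}],
-- so the coefficient of the ridge (i , w) is (-1)^i if f with its i-th
-- vertex deleted equals w with its i-th vertex deleted, and 0 otherwise.
∂ : ∀ {r} {ps : Vec ℕ r} → Facet ps → Ridge ps → ℚ
∂ f (i , w) = if agreeOff f w i then sign (Data.Fin.toℕ i) else 0ℚ

sumℚ : List ℚ → ℚ
sumℚ []       = 0ℚ
sumℚ (x ∷ xs) = x ℚ.+ sumℚ xs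

SimpIndep : ∀ {r} (ps : Vec ℕ r) → (Facet ps → Bool) → Set
SimpIndep ps S =
  (c : Facet ps → ℚ) →
  (∀ f → S f ≡ false → c f ≡ 0ℚ) →
  (∀ (ρ : Ridge ps) → sumℚ (map (λ f → c f ℚ.* ∂ f ρ) (allFacets ps)) ≡ 0ℚ) →
  ∀ f → c f ≡ 0ℚ

SumIndep : ∀ {r} (N : ℕ) (ps : Vec ℕ r) → (Fin N × Facet ps → Bool) → Set
SumIndep N ps S = ∀ (j : Fin N) → SimpIndep ps (λ f → S (j , f))

Dual : ∀ {ℓ ℓ'} {E E' : Set} → ((E → Bool) → Set ℓ) → ((E' → Bool) → Set ℓ') → Set (ℓ ⊔ ℓ')
Dual {E = E} {E'} Ind Ind' =
  Σ (E ↔ E') λ σ → ∀ (B : E → Bool) →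
    IsBasis Ind B ⇔ IsBasis Ind' (λ x → not (B (Inverse.from σ x)))

{-# OPTIONS --safe #-}

-- Let n = N p₁⋯pᵣ with N = ∏ pᵢ^(mᵢ-1).  Writing exponents as j + N Σᵢ fᵢ P/pᵢ (P = p₁⋯pᵣ) identifies
-- ℤ/n with N copies of the set of facets, and turns the powers of ζ into ζ^j ∏ᵢ ωᵢ^fᵢ with ωᵢ of order pᵢ.
-- The dependent sets of the two matroids are governed by the space J of rational relations among the
-- powers of ζ and the space Z of blockwise cycles.  The rows of the boundary matrix lie in J, being geometric
-- sums over the pᵢ-th roots of unity, and J ⊥ Z: a relation vanishes at every conjugate ζ^k with k coprime
-- to n (irreducibility of the cyclotomic polynomial, by Landau's argument), a cycle vanishes at every
-- ζ^k with some pᵢ | k, and Parseval's identity for ℤ/n combines the two.  Since Z is by definition the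
-- orthogonal complement of the rows, J = Z^⊥ by the Fredholm alternative, and matroids represented by
-- orthogonal complements are dual.
module Submission where

open import Defs
open import Data.Nat using (ℕ; _≤_)
open import Data.Nat.Primality using (Prime)
open import Data.Fin using (Fin)
open import Data.Vec using (Vec; lookup)
open import Data.Product using (_×_)
open import Relation.Binary.PropositionalEquality using (_≡_)

open import Algebra.Bundles using (CommutativeRing)
open import Algebra.Morphism.Structures using (module RingMorphisms)
import Algebra.Solver.Ring
open import Algebra.Solver.Ring.AlmostCommutativeRing using (fromCommutativeRing; _-Raw-AlmostCommutative⟶_)
open import Data.Bool using (Bool; true; false; not; _∧_; if_then_else_)
open import Data.Bool.Properties using (not-involutive)
open import Data.Empty using (⊥-elim)
open import Data.Fin as Fin using (zero; suc; toℕ; inject₁; fromℕ<; remQuot; combine; _↑ˡ_; _↑ʳ_)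
import Data.Fin.Properties as Finₚ
open import Data.Integer as ℤ using (ℤ; +_; -[1+_])
import Data.Integer.Properties as ℤₚ
open import Data.List using (List; []; _∷_; _++_; map; concatMap; tabulate; allFin; cartesianProduct)
import Data.List.Properties as Listₚ
open import Data.List.Membership.Propositional using (_∈_; lose)
open import Data.List.Membership.Propositional.Properties using (∈-allFin; ∈-map⁺; ∈-concatMap⁺; ∈-cartesianProduct⁺)
open import Data.List.Relation.Unary.All as All using (All; []; _∷_)
import Data.List.Relation.Unary.All.Properties as Allₚ
open import Data.List.Relation.Unary.Any using (here)
open import Data.Maybe using (Maybe; just; nothing)
open import Data.Nat as ℕ using (zero; suc; NonZero)
import Data.Nat.Properties as ℕₚ
open import Data.Nat.Combinatorics using (_C_; nCn≡1; nCk≡n!/k![n-k]!; k![n∸k]!∣n!)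
open import Data.Nat.Coprimality using (Coprime; coprime?; coprime-+; gcd≡1⇒coprime)
import Data.Nat.Divisibility as ℕᵈ
open import Data.Nat.DivMod using (_%_; _/_; m%n<n; m≡m%n+[m/n]*n; [m+kn]%n≡m%n; m<n⇒m%n≡m; m/n*n≡m)
open import Data.Nat.GCD using (gcd; gcd[m,n]∣m; gcd[m,n]∣n)
open import Data.Nat.ListAction using (product)
open import Data.Nat.ListAction.Properties using (∈⇒∣product)
open import Data.Nat.Primality using (prime?; euclidsLemma; ¬prime[1]; prime⇒nonZero; prime⇒nonTrivial; prime⇒irreducible)
open import Data.Nat.Primality.Factorisation using (factorise; PrimeFactorisation)
open import Data.Product using (Σ; _,_; ∃; proj₁; proj₂; uncurry)
open import Data.Product.Function.NonDependent.Propositional using (_×-↔_)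
open import Data.Rational as ℚ using (ℚ; 0ℚ; 1ℚ; mkℚ)
import Data.Rational.Properties as ℚₚ
open import Data.Rational.Literals using (fromℤ)
import Data.Rational.Solver
import Data.Rational.Unnormalised as ℚᵘ
import Data.Rational.Unnormalised.Properties as ℚᵘₚ
open import Data.Sum as Sum using (_⊎_; inj₁; inj₂)
open import Data.Unit using (tt)
open import Data.Vec using ([]; _∷_)
open import Function using (_∘_; _↔_; Inverse; mk↔ₛ′; mk⇔)
open import Function.Construct.Composition using (_↔-∘_)
open import Function.Construct.Identity using (↔-id)
open import Function.Construct.Symmetry using (↔-sym)
open import Level using (Level; _⊔_)
open import Relation.Binary using (tri<; tri≈; tri>)
open import Relation.Binary.PropositionalEquality as ≡ using (_≢_)
open import Relation.Nullary using (¬_; Dec; yes; no; contradiction; does; _×-dec_)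

-- Equality in `K` is not decidable, and this shapes the whole argument: a basis of the span of the
-- powers of ζ, and with it the vanishing of a relation at a conjugate, is reached only up to double
-- negation. Everything is therefore aimed at `f ∙ g ≡ 0ℚ`, an equation between rationals, where
-- deciding equality discharges the double negation. Elimination takes place over ℚ alone. Landau's
-- argument fits this setting because it works with a lattice instead of factoring polynomials: ℤ[ζ]
-- has bounded denominators, so among finitely many of its elements only 0 is divisible by a large
-- prime. It reaches the exponents that are products of primes beyond a bound; any k coprime to n is
-- moved within its residue class modulo n to a number all of whose prime factors exceed that bound.
-- The exponents j + N Σᵢ fᵢ P/pᵢ are chosen so that raising ζ to k makes the character in direction
-- i trivial exactly when pᵢ divides k. A trivial direction makes cycles vanish, a nontrivial one
-- makes boundary rows vanish.

module _ where
  open import Data.Nat using (_+_; _*_; _∸_; _^_; _!; _<_; z≤n; s≤s; NonZero)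
  open import Data.Nat.Properties
  open import Data.Nat.Divisibility
  open import Data.Nat.Solver using (module +-*-Solver)
  open import Relation.Binary.PropositionalEquality

  -- Factorials, binomial coefficients and residues coprime to n

  ∣m+n∣n⇒∣m : ∀ {d m n} → d ∣ m + n → d ∣ n → d ∣ m
  ∣m+n∣n⇒∣m {d} {m} {n} d∣m+n = ∣m+n∣m⇒∣n (subst (d ∣_) (+-comm m n) d∣m+n)

  m∣m! : ∀ m .{{_ : NonZero m}} → m ∣ m !
  m∣m! (suc m) = m∣m*n (m !)

  prime∤! : ∀ {p} → Prime p → ∀ k → k < p → ¬ (p ∣ k !)
  prime∤! p-prime zero _ p∣1 = ¬prime[1] (subst Prime (∣1⇒≡1 p∣1) p-prime)
  prime∤! p-prime (suc k) k<p p∣ with euclidsLemma (suc k) (k !) p-prime p∣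
  ... | inj₁ p∣k+1 = >⇒∤ k<p p∣k+1
  ... | inj₂ p∣k!  = prime∤! p-prime k (<-trans (n<1+n k) k<p) p∣k!

  -- The prime divides `p !`, which is the coefficient times two factorials of numbers below p, and
  -- it divides neither of those.
  prime∣binomial : ∀ {p k} → Prime p → 0 < k → k < p → p ∣ p C k
  prime∣binomial {p} {k} p-prime 0<k k<p with euclidsLemma (p C k) (k ! * (p ∸ k) !) p-prime p∣C*k!l!
    where
    instance
      _ = prime⇒nonZero p-prime
      _ = k !* (p ∸ k) !≢0
    p∣C*k!l! : p ∣ (p C k) * (k ! * (p ∸ k) !)
    p∣C*k!l! = subst (p ∣_) (sym (trans (cong (_* (k ! * (p ∸ k) !)) (nCk≡n!/k![n-k]! (<⇒≤ k<p)))
      (m/n*n≡m (k![n∸k]!∣n! (<⇒≤ k<p))))) (m∣m! p)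
  ... | inj₁ p∣C = p∣C
  ... | inj₂ p∣k!l! with euclidsLemma (k !) ((p ∸ k) !) p-prime p∣k!l!
  ...   | inj₁ p∣k! = contradiction p∣k! (prime∤! p-prime k k<p)
  ...   | inj₂ p∣l! = contradiction p∣l! (prime∤! p-prime (p ∸ k) (∸-monoʳ-< 0<k (<⇒≤ k<p)))

  -- When the prime A + 1 divides m ≡ k (mod n), it divides neither n nor A !, so that
  -- adding n * A ! repairs it without disturbing the smaller primes.
  coprime⇒rough-representative : ∀ {k n} → Coprime k n → ∀ A →
    ∃ λ t → ∀ q → q ≤ A → Prime q → ¬ (q ∣ k + n * t)
  coprime⇒rough-representative {k} {n} cop zero = 0 , λ where
    zero z≤n 0-prime _ → contradiction (prime⇒nonZero 0-prime) λ ()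
  coprime⇒rough-representative {k} {n} cop (suc A)
    with coprime⇒rough-representative cop A
  ... | t , rough with prime? (suc A) ×-dec (suc A ∣? k + n * t)
  ...   | no ¬bad = t , λ q q≤ q-prime → case (m≤n⇒m<n∨m≡n q≤) q-prime
    where
    case : ∀ {q} → q < suc A ⊎ q ≡ suc A → Prime q → ¬ (q ∣ k + n * t)
    case (inj₁ (s≤s q≤A)) q-prime = rough _ q≤A q-prime
    case (inj₂ refl) q-prime q∣ = ¬bad (q-prime , q∣)
  ...   | yes (p-prime , p∣m) = t + A ! , λ q q≤ q-prime q∣ →
          case (m≤n⇒m<n∨m≡n q≤) q-prime (subst (q ∣_)
            (trans (cong (λ x → k + x) (*-distribˡ-+ n t (A !))) (sym (+-assoc k (n * t) (n * A !)))) q∣)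
    where
    case : ∀ {q} → q < suc A ⊎ q ≡ suc A → Prime q → ¬ (q ∣ k + n * t + n * A !)
    case {q} (inj₁ (s≤s q≤A)) q-prime q∣ = rough q q≤A q-prime (∣m+n∣n⇒∣m q∣
      (∣n⇒∣m*n n (∣-trans (m∣m! q {{prime⇒nonZero q-prime}}) (m≤n⇒m!∣n! q≤A))))
    case (inj₂ refl) _ q∣ with euclidsLemma n (A !) p-prime (∣m+n∣m⇒∣n q∣ p∣m)
    ... | inj₁ p∣n  = ¬prime[1] (subst Prime (cop (∣m+n∣n⇒∣m p∣m (∣m⇒∣m*n t p∣n) , p∣n)) p-prime)
    ... | inj₂ p∣A! = prime∤! p-prime A ≤-refl p∣A!

  -- Products of primes, and facets as exponents modulo n

  prime∣prime⇒≡ : ∀ {p q} → Prime p → Prime q → p ∣ q → p ≡ q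
  prime∣prime⇒≡ p-prime q-prime p∣q with prime⇒irreducible q-prime p∣q
  ... | inj₁ refl = contradiction p-prime ¬prime[1]
  ... | inj₂ p≡q  = p≡q

  prime∣^⇒∣ : ∀ {p} → Prime p → ∀ q m → p ∣ q ^ m → p ∣ q
  prime∣^⇒∣ p-prime q zero p∣1 = contradiction (subst Prime (∣1⇒≡1 p∣1) p-prime) ¬prime[1]
  prime∣^⇒∣ p-prime q (suc m) p∣ with euclidsLemma q (q ^ m) p-prime p∣
  ... | inj₁ p∣q   = p∣q
  ... | inj₂ p∣q^m = prime∣^⇒∣ p-prime q m p∣q^m

  prime∣prodℕ⇒∃∣ : ∀ {p r} → Prime p → (xs : Vec ℕ r) → p ∣ prodℕ xs → ∃ λ i → p ∣ lookup xs i
  prime∣prodℕ⇒∃∣ p-prime [] p∣1 = contradiction (subst Prime (∣1⇒≡1 p∣1) p-prime) ¬prime[1]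
  prime∣prodℕ⇒∃∣ p-prime (x ∷ xs) p∣ with euclidsLemma x (prodℕ xs) p-prime p∣
  ... | inj₁ p∣x = zero , p∣x
  ... | inj₂ p∣xs with prime∣prodℕ⇒∃∣ p-prime xs p∣xs
  ...   | i , p∣xᵢ = suc i , p∣xᵢ

  prodℕ≢0 : ∀ {r} (ps : Vec ℕ r) → (∀ i → Prime (lookup ps i)) → NonZero (prodℕ ps)
  prodℕ≢0 [] _ = _
  prodℕ≢0 (p ∷ ps) primes = m*n≢0 p (prodℕ ps) {{prime⇒nonZero (primes zero)}} {{prodℕ≢0 ps (primes ∘ suc)}}

  prodℕ-powVec : ∀ {r} (ps ms : Vec ℕ r) → (∀ i → 1 ≤ lookup ms i) →
    prodℕ (powVec ps ms) ≡ prodℕ (powVecPred ps ms) * prodℕ ps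
  prodℕ-powVec [] [] _ = refl
  prodℕ-powVec (p ∷ ps) (zero ∷ ms) 1≤ = contradiction (1≤ zero) λ ()
  prodℕ-powVec (p ∷ ps) (suc m ∷ ms) 1≤ = trans (cong (p * p ^ m *_) (prodℕ-powVec ps ms (1≤ ∘ suc)))
    (solve 4 (λ p q a b → p :* q :* (a :* b) := q :* a :* (p :* b)) refl p (p ^ m) (prodℕ (powVecPred ps ms))
        (prodℕ ps))
    where open +-*-Solver

  lookup-powVec : ∀ {r} (ps ms : Vec ℕ r) i → lookup (powVec ps ms) i ≡ lookup ps i ^ lookup ms i
  lookup-powVec (p ∷ ps) (m ∷ ms) zero    = refl
  lookup-powVec (p ∷ ps) (m ∷ ms) (suc i) = lookup-powVec ps ms i

  -- Unfolds to Σᵢ fᵢ P/pᵢ with P the product of `ps`: the tail is a sum relative to the product of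
  -- the tail, and the factor p lifts it to P. This is a Chinese remainder encoding, not a
  -- lexicographic one.
  expo : ∀ {r} (ps : Vec ℕ r) → Facet ps → ℕ
  expo []       _       = 0
  expo (p ∷ ps) (a , f) = toℕ a * prodℕ ps + p * expo ps f

  -- Congruence modulo m without subtraction: a multiple of m may be added on either side.
  Congruent : ℕ → ℕ → ℕ → Set
  Congruent m x y = ∃ λ s → ∃ λ t → x + m * s ≡ y + m * t

  -- Modulo p the equation reads a P ≡ b P with P invertible, so p divides b - a, which is smaller
  -- than p. The order of a and b keeps the truncated subtraction exact.
  residue-unique-≤ : ∀ {p P a b x y} → Prime p → ¬ (p ∣ P) → a ≤ b → b < p →
    a * P + p * x ≡ b * P + p * y → a ≡ b
  residue-unique-≤ {p} {P} {a} {b} {x} {y} p-prime p∤P a≤b b<p e with euclidsLemma (b ∸ a) P p-prime p∣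
    where
    open +-*-Solver
    p∣ : p ∣ (b ∸ a) * P
    p∣ = ∣m+n∣n⇒∣m {n = p * y} (subst (p ∣_) (+-cancelˡ-≡ (a * P) _ _ (trans e
      (trans (cong (λ z → z * P + p * y) (sym (m+[n∸m]≡n a≤b)))
        (solve 4 (λ a c P z → (a :+ c) :* P :+ z := a :* P :+ (c :* P :+ z)) refl a (b ∸ a) P (p * y)))))
      (m∣m*n x)) (m∣m*n y)
  ... | inj₂ p∣P = contradiction p∣P p∤P
  ... | inj₁ p∣b-a with b ∸ a in eq
  ...   | zero  = ≤-antisym a≤b (m∸n≡0⇒m≤n eq)
  ...   | suc d = contradiction p∣b-a (>⇒∤ (≤-<-trans (subst (_≤ b) eq (m∸n≤m b a)) b<p))

  residue-unique : ∀ {p P a b x y} → Prime p → ¬ (p ∣ P) → a < p → b < p →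
    a * P + p * x ≡ b * P + p * y → a ≡ b
  residue-unique {a = a} {b} p-prime p∤P a<p b<p e with ≤-total a b
  ... | inj₁ a≤b = residue-unique-≤ p-prime p∤P a≤b b<p e
  ... | inj₂ b≤a = sym (residue-unique-≤ p-prime p∤P b≤a a<p (sym e))

  -- Reduction modulo p leaves only the first vertex, multiplied by P, which p does not divide
  -- because the primes are distinct. Once the first vertices agree, their term cancels, and
  -- division by p leaves the same problem for the tail modulo P.
  expo-injective : ∀ {r} (ps : Vec ℕ r) → (∀ i → Prime (lookup ps i)) →
    (∀ i j → lookup ps i ≡ lookup ps j → i ≡ j) →
    ∀ f g → Congruent (prodℕ ps) (expo ps f) (expo ps g) → f ≡ g
  expo-injective [] _ _ tt tt _ = refl
  expo-injective (p ∷ ps) primes distinct (a , f) (b , g) (s , t , e) = cong₂ _,_ a≡b f≡g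
    where
    open +-*-Solver
    P = prodℕ ps
    p∤P : ¬ (p ∣ P)
    p∤P p∣P with prime∣prodℕ⇒∃∣ (primes zero) ps p∣P
    ... | i , p∣pᵢ = contradiction (distinct zero (suc i) (prime∣prime⇒≡ (primes zero) (primes (suc i)) p∣pᵢ)) λ ()
    regroup : ∀ a x s → (a * P + p * x) + p * P * s ≡ a * P + p * (x + P * s)
    regroup a x s = solve 5 (λ a P p x s → (a :* P :+ p :* x) :+ p :* P :* s := a :* P :+ p :* (x :+ P :* s)) refl a
        P p x s
    e′ : toℕ a * P + p * (expo ps f + P * s) ≡ toℕ b * P + p * (expo ps g + P * t)
    e′ = trans (sym (regroup (toℕ a) (expo ps f) s)) (trans e (regroup (toℕ b) (expo ps g) t))
    a≡b : a ≡ b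
    a≡b = Finₚ.toℕ-injective (residue-unique {x = expo ps f + P * s} {y = expo ps g + P * t} (primes zero) p∤P
        (Finₚ.toℕ<n a) (Finₚ.toℕ<n b) e′)
    f≡g : f ≡ g
    f≡g = expo-injective ps (primes ∘ suc) (λ i j h → Finₚ.suc-injective (distinct (suc i) (suc j) h)) f g
      (s , t , *-cancelˡ-≡ _ _ p {{prime⇒nonZero (primes zero)}} (+-cancelˡ-≡ (toℕ b * P) _ _
        (subst (λ c → toℕ c * P + p * (expo ps f + P * s) ≡ toℕ b * P + p * (expo ps g + P * t)) a≡b e′)))

  facet↔ : ∀ {r} (ps : Vec ℕ r) → Fin (prodℕ ps) ↔ Facet ps
  facet↔ []       = Finₚ.1↔⊤
  facet↔ (p ∷ ps) = (↔-id (Fin p) ×-↔ facet↔ ps) ↔-∘ Finₚ.*↔×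

  -- Pigeonhole: a missed value y, adjoined to g as one more entry, would embed `Fin (suc n)` into
  -- `Fin n`.
  injective⇒permutation : ∀ {n} (g : Fin n → Fin n) → (∀ {x y} → g x ≡ g y → x ≡ y) → Fin n ↔ Fin n
  injective⇒permutation {n} g g-inj = mk↔ₛ′ g (proj₁ ∘ preimage) (proj₂ ∘ preimage) λ x → g-inj (proj₂ (preimage (g x)))
    where
    preimage : ∀ y → ∃ λ x → g x ≡ y
    preimage y with Finₚ.any? (λ x → g x Fin.≟ y)
    ... | yes ∃x = ∃x
    ... | no ∄x = contradiction (Finₚ.injective⇒≤ h-injective) 1+n≰n
      where
      h : Fin (suc n) → Fin n
      h zero    = y
      h (suc x) = g x
      h-injective : ∀ {x x′} → h x ≡ h x′ → x ≡ x′
      h-injective {zero}  {zero}   _ = refl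
      h-injective {zero}  {suc x′} e = contradiction (x′ , sym e) ∄x
      h-injective {suc x} {zero}   e = contradiction (x , e) ∄x
      h-injective {suc x} {suc x′} e = cong suc (g-inj e)

  module Encoding (N : ℕ) {r} (ps : Vec ℕ r) (primes : ∀ i → Prime (lookup ps i))
    (distinct : ∀ i j → lookup ps i ≡ lookup ps j → i ≡ j) .{{_ : NonZero (N * prodℕ ps)}} where

    private
      P = prodℕ ps
      instance
        N≢0 : NonZero N
        N≢0 = m*n≢0⇒m≢0 N {P}

    -- Chosen so that ζ^(exponent (j , f)) = ζ^j ∏ᵢ (ζ^(n/pᵢ))^fᵢ for n = N * prodℕ ps.
    exponent : Fin N × Facet ps → ℕ
    exponent (j , f) = toℕ j + N * expo ps f

    flat↔ : Fin (N * P) ↔ (Fin N × Facet ps)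
    flat↔ = (↔-id (Fin N) ×-↔ facet↔ ps) ↔-∘ Finₚ.*↔×

    abstract
      encode : Fin N × Facet ps → Fin (N * P)
      encode x = fromℕ< (m%n<n (exponent x) (N * P))

      toℕ-encode : ∀ x → toℕ (encode x) ≡ exponent x % (N * P)
      toℕ-encode x = Finₚ.toℕ-fromℕ< (m%n<n (exponent x) (N * P))

      -- Equal remainders become an equation once each side receives the other side's multiple of N
      -- P. Modulo N it determines j; cancelling j and dividing by N gives a congruence modulo P
      -- between the facet exponents.
      encode-injective : ∀ x y → encode x ≡ encode y → x ≡ y
      encode-injective x@(j , f) y@(j′ , f′) e = cong₂ _,_ j≡j′ (expo-injective ps primes distinct f f′ congruent)
        where
        open +-*-Solver
        s t : ℕ
        s = exponent x / (N * P)
        t = exponent y / (N * P)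
        %≡ : exponent x % (N * P) ≡ exponent y % (N * P)
        %≡ = trans (sym (toℕ-encode x)) (trans (cong toℕ e) (toℕ-encode y))
        regroup : ∀ j x t → j + N * x + t * (N * P) ≡ j + N * (x + P * t)
        regroup j x t = solve 5 (λ j N x t P → j :+ N :* x :+ t :* (N :* P) := j :+ N :* (x :+ P :* t)) refl j N x t P
        e′ : toℕ j + N * (expo ps f + P * t) ≡ toℕ j′ + N * (expo ps f′ + P * s)
        e′ = trans (sym (regroup (toℕ j) (expo ps f) t))
            (trans (cross (exponent x) (exponent y) %≡) (regroup (toℕ j′) (expo ps f′) s))
          where
          cross : ∀ a b → a % (N * P) ≡ b % (N * P) → a + b / (N * P) * (N * P) ≡ b + a / (N * P) * (N * P)
          cross a b h = trans (cong (_+ b / (N * P) * (N * P)) (m≡m%n+[m/n]*n a (N * P)))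
            (trans (solve 3 (λ r u v → r :+ u :+ v := r :+ v :+ u) refl (a % (N * P)) (a / (N * P) * (N * P))
                (b / (N * P) * (N * P)))
            (cong (_+ a / (N * P) * (N * P)) (trans (cong (_+ b / (N * P) * (N * P)) h)
                (sym (m≡m%n+[m/n]*n b (N * P))))))
        mod-N : ∀ (j : Fin N) x → (toℕ j + N * x) % N ≡ toℕ j
        mod-N j x = trans (cong (λ z → (toℕ j + z) % N) (*-comm N x))
            (trans ([m+kn]%n≡m%n (toℕ j) x N) (m<n⇒m%n≡m (Finₚ.toℕ<n j)))
        j≡j′ : j ≡ j′
        j≡j′ = Finₚ.toℕ-injective (trans (sym (mod-N j (expo ps f + P * t)))
            (trans (cong (_% N) e′) (mod-N j′ (expo ps f′ + P * s))))
        congruent : Congruent P (expo ps f) (expo ps f′)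
        congruent = t , s , *-cancelˡ-≡ _ _ N
            (+-cancelˡ-≡ (toℕ j′) _ _ (trans (cong (λ i → toℕ i + N * (expo ps f + P * t)) (sym j≡j′)) e′))

      permutation : Fin (N * P) ↔ Fin (N * P)
      permutation = injective⇒permutation (encode ∘ Inverse.to flat↔)
        λ {x} {y} e → flat-injective (encode-injective _ _ e)
        where
        flat-injective : ∀ {x y} → Inverse.to flat↔ x ≡ Inverse.to flat↔ y → x ≡ y
        flat-injective {x} {y} e = trans (sym (Inverse.strictlyInverseʳ flat↔ x))
            (trans (cong (Inverse.from flat↔) e) (Inverse.strictlyInverseʳ flat↔ y))

      permutation-to : ∀ x → Inverse.to permutation x ≡ encode (Inverse.to flat↔ x)
      permutation-to _ = refl

      -- Undoing the permutation before unflattening makes `encode` the inverse direction; its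
      -- surjectivity comes from counting.
      encode↔ : Fin (N * P) ↔ (Fin N × Facet ps)
      encode↔ = flat↔ ↔-∘ ↔-sym permutation

      encode↔-from : ∀ x → Inverse.from encode↔ x ≡ encode x
      encode↔-from x = cong encode (Inverse.strictlyInverseˡ flat↔ x)

-- Sums over facets

module FacetSum {c ℓ} (R : CommutativeRing c ℓ) where
  open CommutativeRing R hiding (zero)
  open import Relation.Binary.Reasoning.Setoid setoid
  open import Algebra.Properties.CommutativeMonoid.Sum +-commutativeMonoid
    using (sum; ∑-comm; sum-permute; sum-cong-≋; sum-replicate-zero)
  open import Algebra.Properties.Semiring.Sum semiring using (*-distribˡ-sum)
  open import Algebra.Properties.Semiring.Exp semiring using (_^_)

  sumFacet : ∀ {r} (ps : Vec ℕ r) → (Facet ps → Carrier) → Carrier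
  sumFacet []       g = g tt
  sumFacet (p ∷ ps) g = sum (λ a → sumFacet ps (λ f → g (a , f)))

  sumFacet-cong : ∀ {r} (ps : Vec ℕ r) {g h} → (∀ f → g f ≈ h f) → sumFacet ps g ≈ sumFacet ps h
  sumFacet-cong []       e = e tt
  sumFacet-cong (p ∷ ps) e = sum-cong-≋ (λ a → sumFacet-cong ps (λ f → e (a , f)))

  sumFacet-*ˡ : ∀ {r} (ps : Vec ℕ r) x g → sumFacet ps (λ f → x * g f) ≈ x * sumFacet ps g
  sumFacet-*ˡ []       x g = refl
  sumFacet-*ˡ (p ∷ ps) x g = trans (sum-cong-≋ (λ a → sumFacet-*ˡ ps x (λ f → g (a , f))))
    (sym (*-distribˡ-sum x (λ a → sumFacet ps (λ f → g (a , f)))))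

  sumFacet-zero : ∀ {r} (ps : Vec ℕ r) {g} → (∀ f → g f ≈ 0#) → sumFacet ps g ≈ 0#
  sumFacet-zero ps {g} g≈0 = trans (sumFacet-cong ps (λ f → trans (g≈0 f) (sym (zeroˡ (g f)))))
    (trans (sumFacet-*ˡ ps 0# g) (zeroˡ _))

  sum-sumFacet : ∀ {r n} (ps : Vec ℕ r) (g : Fin n → Facet ps → Carrier) →
    sum (λ a → sumFacet ps (g a)) ≈ sumFacet ps (λ f → sum (λ a → g a f))
  sum-sumFacet []       g = refl
  sum-sumFacet (p ∷ ps) g = trans (∑-comm (λ a b → sumFacet ps (λ f → g a (b , f))))
    (sum-cong-≋ (λ b → sum-sumFacet ps (λ a f → g a (b , f))))

  sum-only : ∀ {n} (f : Fin n → Carrier) x → (∀ k → k ≢ x → f k ≈ 0#) → sum f ≈ f x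
  sum-only {suc n} f zero h = trans (+-congˡ
      (trans (sum-cong-≋ (λ k → h (suc k) λ ())) (sum-replicate-zero n))) (+-identityʳ _)
  sum-only {suc n} f (suc x) h = trans
    (+-cong (h zero λ ()) (sum-only (f ∘ suc) x (λ k k≢x → h (suc k) λ { ≡.refl → k≢x ≡.refl })))
    (+-identityˡ _)

  indicator : Bool → Carrier
  indicator b = if b then 1# else 0#

  sum-indicator : ∀ {n} (b : Fin n) (g : Fin n → Carrier) (B : Fin n → Bool) →
    sum (λ a → g a * indicator (does (a Fin.≟ b) ∧ B a)) ≈ g b * indicator (B b)
  sum-indicator b g B = trans (sum-only _ b off) on
    where
    off : ∀ k → k ≢ b → g k * indicator (does (k Fin.≟ b) ∧ B k) ≈ 0#
    off k k≢b with k Fin.≟ b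
    ... | yes k≡b = contradiction k≡b k≢b
    ... | no _ = zeroʳ (g k)
    on : g b * indicator (does (b Fin.≟ b) ∧ B b) ≈ g b * indicator (B b)
    on with b Fin.≟ b
    ... | yes _ = refl
    ... | no b≢b = contradiction ≡.refl b≢b

  sumFacet-agreeAll : ∀ {r} (ps : Vec ℕ r) (w : Facet ps) g →
    sumFacet ps (λ f → g f * indicator (agreeAll {ps = ps} f w)) ≈ g w
  sumFacet-agreeAll []       tt      g = *-identityʳ _
  sumFacet-agreeAll (p ∷ ps) (b , w) g = begin
    sum (λ a → sumFacet ps (λ f → g (a , f) * indicator (does (a Fin.≟ b) ∧ agreeAll {ps = ps} f w)))
      ≈⟨ sum-sumFacet {n = p} ps _ ⟩
    sumFacet ps (λ f → sum (λ a → g (a , f) * indicator (does (a Fin.≟ b) ∧ agreeAll {ps = ps} f w)))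
      ≈⟨ sumFacet-cong ps (λ f → sum-indicator b (λ a → g (a , f)) (λ _ → agreeAll {ps = ps} f w)) ⟩
    sumFacet ps (λ f → g (b , f) * indicator (agreeAll {ps = ps} f w))
      ≈⟨ sumFacet-agreeAll ps w (λ f → g (b , f)) ⟩
    g (b , w) ∎

  -- Up to the sign (-1)^i, the coefficient of the ridge (i , w) in the boundary of the chain g. The
  -- ring is arbitrary so that it applies both to rational chains and to monomials in K.
  agreeOff-sum : ∀ {r} (ps : Vec ℕ r) → (Facet ps → Carrier) → Facet ps → Fin r → Carrier
  agreeOff-sum ps g w i = sumFacet ps (λ f → g f * indicator (agreeOff {ps = ps} f w i))

  agreeOff-sum-zero : ∀ {r p} (ps : Vec ℕ r) g (w : Facet (p ∷ ps)) →
    agreeOff-sum (p ∷ ps) g w zero ≈ sum (λ a → g (a , proj₂ w))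
  agreeOff-sum-zero ps g (b , w) = sum-cong-≋ (λ a → sumFacet-agreeAll ps w (λ f → g (a , f)))

  agreeOff-sum-suc : ∀ {r p} (ps : Vec ℕ r) g (w : Facet (p ∷ ps)) i →
    agreeOff-sum (p ∷ ps) g w (suc i) ≈ agreeOff-sum ps (λ f → g (proj₁ w , f)) (proj₂ w) i
  agreeOff-sum-suc {p = p} ps g (b , w) i = trans (sum-sumFacet {n = p} ps _)
    (sumFacet-cong ps (λ f → sum-indicator b (λ a → g (a , f)) (λ _ → agreeOff {ps = ps} f w i)))

  monomial : ∀ {r} {ps : Vec ℕ r} → Vec Carrier r → Facet ps → Carrier
  monomial {ps = []}     []       tt      = 1#
  monomial {ps = p ∷ ps} (y ∷ ys) (a , f) = y ^ toℕ a * monomial ys f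

  sum-+ : ∀ m {n} (h : Fin (m ℕ.+ n) → Carrier) → sum h ≈ sum (h ∘ (_↑ˡ n)) + sum (h ∘ (m ↑ʳ_))
  sum-+ zero    h = sym (+-identityˡ _)
  sum-+ (suc m) h = trans (+-congˡ (sum-+ m (h ∘ suc))) (sym (+-assoc _ _ _))

  sum-* : ∀ m n (h : Fin (m ℕ.* n) → Carrier) → sum h ≈ sum (λ i → sum (λ j → h (combine {m} {n} i j)))
  sum-* zero    n h = refl
  sum-* (suc m) n h = trans (sum-+ n h) (+-congˡ (sum-* m n (h ∘ (n ↑ʳ_))))

  sum-facet↔ : ∀ {r} (ps : Vec ℕ r) g → sum (g ∘ Inverse.to (facet↔ ps)) ≈ sumFacet ps g
  sum-facet↔ []       g = +-identityʳ (g tt)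
  sum-facet↔ (p ∷ ps) g = trans (sum-* p (prodℕ ps) _) (sum-cong-≋ {p} λ a →
    trans (sum-cong-≋ {prodℕ ps} (λ x → reflexive (≡.cong (λ ax → g (proj₁ ax , Inverse.to (facet↔ ps) (proj₂ ax)))
      (Finₚ.remQuot-combine a x)))) (sum-facet↔ ps (λ f → g (a , f))))

  sum-encode : ∀ N {r} (ps : Vec ℕ r) primes distinct .{{_ : NonZero (N ℕ.* prodℕ ps)}} h →
    sum h ≈ sum (λ j → sumFacet ps (λ f → h (Encoding.encode N ps primes distinct (j , f))))
  sum-encode N ps primes distinct h = trans (sum-permute h permutation) (trans
    (sum-cong-≋ {N ℕ.* prodℕ ps} (λ x → reflexive (≡.cong h (permutation-to x)))) (trans (sum-* N (prodℕ ps) _)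
    (sum-cong-≋ {N} λ j → trans (sum-cong-≋ {prodℕ ps}
        (λ x → reflexive (≡.cong (λ jx → h (encode (proj₁ jx , Inverse.to (facet↔ ps) (proj₂ jx))))
      (Finₚ.remQuot-combine j x)))) (sum-facet↔ ps (λ f → h (encode (j , f)))))))
    where open Encoding N ps primes distinct

-- Integers and denominators inside ℚ

module _ where
  open import Data.Rational.Solver using (module +-*-Solver)
  open import Relation.Binary.PropositionalEquality

  fromℕ : ℕ → ℚ
  fromℕ m = fromℤ (+ m)

  fromℤ-+ : ∀ a b → fromℤ (a ℤ.+ b) ≡ fromℤ a ℚ.+ fromℤ b
  fromℤ-+ a b = ℚₚ.toℚᵘ-injective (ℚᵘₚ.≃-trans
    (ℚᵘ.*≡* (cong (ℤ._* + 1) (sym (cong₂ ℤ._+_ (ℤₚ.*-identityʳ a) (ℤₚ.*-identityʳ b)))))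
    (ℚᵘₚ.≃-sym (ℚₚ.toℚᵘ-homo-+ (fromℤ a) (fromℤ b))))

  fromℤ-* : ∀ a b → fromℤ (a ℤ.* b) ≡ fromℤ a ℚ.* fromℤ b
  fromℤ-* a b = ℚₚ.toℚᵘ-injective (ℚᵘₚ.≃-sym (ℚₚ.toℚᵘ-homo-* (fromℤ a) (fromℤ b)))

  fromℤ-neg : ∀ a → fromℤ (ℤ.- a) ≡ ℚ.- fromℤ a
  fromℤ-neg (+ zero)  = refl
  fromℤ-neg ℤ.+[1+ n ] = refl
  fromℤ-neg -[1+ n ]  = refl

  fromℤ-injective : ∀ {a b} → fromℤ a ≡ fromℤ b → a ≡ b
  fromℤ-injective eq = cong ℚ.numerator eq

  fromℕ-suc : ∀ m → fromℕ (suc m) ≡ 1ℚ ℚ.+ fromℕ m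
  fromℕ-suc m = fromℤ-+ (+ 1) (+ m)

  fromℕ-* : ∀ a b → fromℕ (a ℕ.* b) ≡ fromℕ a ℚ.* fromℕ b
  fromℕ-* a b = trans (cong fromℤ (ℤₚ.pos-* a b)) (fromℤ-* (+ a) (+ b))

  fromℕ≢0 : ∀ m .{{_ : NonZero m}} → fromℕ m ≢ 0ℚ
  fromℕ≢0 (suc m) ()

  IsInt : ℚ → Set
  IsInt q = ∃ λ z → q ≡ fromℤ z

  IsInt-+ : ∀ {p q} → IsInt p → IsInt q → IsInt (p ℚ.+ q)
  IsInt-+ (a , refl) (b , refl) = a ℤ.+ b , sym (fromℤ-+ a b)

  IsInt-* : ∀ {p q} → IsInt p → IsInt q → IsInt (p ℚ.* q)
  IsInt-* (a , refl) (b , refl) = a ℤ.* b , sym (fromℤ-* a b)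

  IsInt-neg : ∀ {p} → IsInt p → IsInt (ℚ.- p)
  IsInt-neg (a , refl) = ℤ.- a , sym (fromℤ-neg a)

  denominator-clears : ∀ q → IsInt (fromℕ (ℚ.denominatorℕ q) ℚ.* q)
  denominator-clears q@(mkℚ a d-1 _) = a , ℚₚ.toℚᵘ-injective (ℚᵘₚ.≃-trans
    (ℚₚ.toℚᵘ-homo-* (fromℕ (suc d-1)) q)
    (ℚᵘ.*≡* (trans (ℤₚ.*-identityʳ (+ suc d-1 ℤ.* a)) (trans (ℤₚ.*-comm (+ suc d-1) a)
      (cong (λ k → a ℤ.* + suc k) (sym (ℕₚ.+-identityʳ d-1)))))))

  common-denominator : ∀ m (q : Fin m → ℚ) →
    ∃ λ D → NonZero D × (∀ i → IsInt (fromℕ D ℚ.* q i))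
  common-denominator zero q = 1 , _ , λ ()
  common-denominator (suc m) q with common-denominator m (q ∘ suc)
  ... | D , D≢0 , int = d ℕ.* D , ℕₚ.m*n≢0 d D {{_}} {{D≢0}} , λ where
          zero → subst IsInt (sym (trans (cong (ℚ._* q zero) (fromℕ-* d D))
                   (solve 3 (λ d D q → (d :* D) :* q := D :* (d :* q)) refl (fromℕ d) (fromℕ D) (q zero))))
                   (IsInt-* (+ D , refl) (denominator-clears (q zero)))
          (suc i) → subst IsInt (sym (trans (cong (ℚ._* q (suc i)) (fromℕ-* d D))
                   (ℚₚ.*-assoc (fromℕ d) (fromℕ D) (q (suc i)))))
                   (IsInt-* (+ d , refl) (int i))
    where
    open +-*-Solver
    d = ℚ.denominatorℕ (q zero)

  *≡0⇒≡0 : ∀ {p q} → p ≢ 0ℚ → p ℚ.* q ≡ 0ℚ → q ≡ 0ℚ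
  *≡0⇒≡0 {p} {q} p≢0 pq≡0 = begin
    q                  ≡⟨ ℚₚ.*-identityˡ q ⟨
    1ℚ ℚ.* q           ≡⟨ cong (ℚ._* q) (ℚₚ.*-inverseˡ p) ⟨
    ℚ.1/ p ℚ.* p ℚ.* q ≡⟨ ℚₚ.*-assoc (ℚ.1/ p) p q ⟩
    ℚ.1/ p ℚ.* (p ℚ.* q) ≡⟨ cong (ℚ.1/ p ℚ.*_) pq≡0 ⟩
    ℚ.1/ p ℚ.* 0ℚ      ≡⟨ ℚₚ.*-zeroʳ (ℚ.1/ p) ⟩
    0ℚ                 ∎
    where
    open ≡-Reasoning
    instance
      p-nonZero : ℚ.NonZero p
      p-nonZero = ℚ.≢-nonZero p≢0

  module ℚF = FacetSum ℚₚ.+-*-commutativeRing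

  module ℚΣ where
    open CommutativeRing ℚₚ.+-*-commutativeRing using (semiring; +-commutativeMonoid)
    open import Algebra.Properties.CommutativeMonoid.Sum +-commutativeMonoid public
      using (sum; ∑-distrib-+; ∑-comm; sum-replicate-zero; sum-cong-≗)
    open import Algebra.Properties.Semiring.Sum semiring public
      using (*-distribˡ-sum; *-distribʳ-sum)

  -- The pairing on ℚⁿ, spans and the Fredholm alternative

  infix 7 _∙_
  _∙_ : ∀ {n} → (Fin n → ℚ) → (Fin n → ℚ) → ℚ
  u ∙ v = ℚΣ.sum (λ k → u k ℚ.* v k)

  ∙-linearˡ : ∀ {n} (u u′ v : Fin n → ℚ) q →
    (λ k → u k ℚ.- q ℚ.* u′ k) ∙ v ≡ u ∙ v ℚ.- q ℚ.* (u′ ∙ v)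
  ∙-linearˡ {zero} u u′ v q = sym (trans (ℚₚ.+-identityˡ _) (cong ℚ.-_ (ℚₚ.*-zeroʳ q)))
  ∙-linearˡ {suc n} u u′ v q = trans
    (cong ((u zero ℚ.- q ℚ.* u′ zero) ℚ.* v zero ℚ.+_) (∙-linearˡ (u ∘ suc) (u′ ∘ suc) (v ∘ suc) q))
    (solve 6 (λ a q b c s t → (a :- q :* b) :* c :+ (s :- q :* t) := (a :* c :+ s) :- q :* (b :* c :+ t)) refl
      (u zero) q (u′ zero) (v zero) _ _)
    where open +-*-Solver

  ∙-linearʳ : ∀ {n} (u v v′ : Fin n → ℚ) q →
    u ∙ (λ k → v k ℚ.- q ℚ.* v′ k) ≡ u ∙ v ℚ.- q ℚ.* (u ∙ v′)
  ∙-linearʳ {zero} u v v′ q = sym (trans (ℚₚ.+-identityˡ _) (cong ℚ.-_ (ℚₚ.*-zeroʳ q)))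
  ∙-linearʳ {suc n} u v v′ q = trans
    (cong (u zero ℚ.* (v zero ℚ.- q ℚ.* v′ zero) ℚ.+_) (∙-linearʳ (u ∘ suc) (v ∘ suc) (v′ ∘ suc) q))
    (solve 6 (λ u q a b s t → u :* (a :- q :* b) :+ (s :- q :* t) := (u :* a :+ s) :- q :* (u :* b :+ t)) refl
      (u zero) q (v zero) (v′ zero) _ _)
    where open +-*-Solver

  ∙-single : ∀ {n} (u v : Fin n → ℚ) x → (∀ k → k ≢ x → u k ℚ.* v k ≡ 0ℚ) → u ∙ v ≡ u x ℚ.* v x
  ∙-single u v = ℚF.sum-only (λ k → u k ℚ.* v k)

  δ : ∀ {n} → Fin n → Fin n → ℚ
  δ x k with k Fin.≟ x
  ... | yes _ = 1ℚ
  ... | no _  = 0ℚ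

  δ-same : ∀ {n} (x : Fin n) → δ x x ≡ 1ℚ
  δ-same x with x Fin.≟ x
  ... | yes _ = refl
  ... | no x≢x = contradiction refl x≢x

  δ-other : ∀ {n} {x k : Fin n} → k ≢ x → δ x k ≡ 0ℚ
  δ-other {x = x} {k} k≢x with k Fin.≟ x
  ... | yes k≡x = contradiction k≡x k≢x
  ... | no _ = refl

  ∙-δ : ∀ {n} (u : Fin n → ℚ) x → u ∙ δ x ≡ u x
  ∙-δ u x = trans (∙-single u (δ x) x (λ k k≢x → trans (cong (u k ℚ.*_) (δ-other k≢x)) (ℚₚ.*-zeroʳ (u k))))
    (trans (cong (u x ℚ.*_) (δ-same x)) (ℚₚ.*-identityʳ (u x)))

  -- Membership is by successive subtraction down to the zero vector, which matches the elimination
  -- in `fredholm` one vector at a time.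
  Span : ∀ {n} → List (Fin n → ℚ) → (Fin n → ℚ) → Set
  Span []       u = ∀ k → u k ≡ 0ℚ
  Span (v ∷ vs) u = ∃ λ q → Span vs (λ k → u k ℚ.- q ℚ.* v k)

  Kills : ∀ {n} → (Fin n → ℚ) → List (Fin n → ℚ) → Set
  Kills y = All (λ v → y ∙ v ≡ 0ℚ)

  Span⊆Kills : ∀ {n} (y : Fin n → ℚ) vs u → Kills y vs → Span vs u → y ∙ u ≡ 0ℚ
  Span⊆Kills {n} y [] u _ u≡0 = trans
    (ℚΣ.sum-cong-≗ {n} (λ k → trans (cong (y k ℚ.*_) (u≡0 k)) (ℚₚ.*-zeroʳ (y k)))) (ℚΣ.sum-replicate-zero n)
  Span⊆Kills y (v ∷ vs) u (yv ∷ yvs) (q , s) = begin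
    y ∙ u                          ≡⟨ solve 3 (λ a q b → a := (a :- q :* b) :+ q :* b) refl (y ∙ u) q (y ∙ v) ⟩
    (y ∙ u ℚ.- q ℚ.* (y ∙ v)) ℚ.+ q ℚ.* (y ∙ v)
      ≡⟨ cong₂ (λ a b → a ℚ.+ q ℚ.* b) (trans (sym (∙-linearʳ y u v q)) (Span⊆Kills y vs _ yvs s)) yv ⟩
    0ℚ ℚ.+ q ℚ.* 0ℚ                 ≡⟨ trans (ℚₚ.+-identityˡ _) (ℚₚ.*-zeroʳ q) ⟩
    0ℚ ∎
    where
    open ≡-Reasoning
    open +-*-Solver

  Span-resp : ∀ {n} (vs : List (Fin n → ℚ)) {u u′} → (∀ k → u k ≡ u′ k) → Span vs u → Span vs u′
  Span-resp [] h s k = trans (sym (h k)) (s k)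
  Span-resp (w ∷ ws) h (q , s) = q , Span-resp ws (λ k → cong (ℚ._- q ℚ.* w k) (h k)) s

  all0? : ∀ {n} (u : Fin n → ℚ) → (∀ k → u k ≡ 0ℚ) ⊎ ∃ λ k → u k ≢ 0ℚ
  all0? {zero} u = inj₁ λ ()
  all0? {suc n} u with u zero ℚ.≟ 0ℚ | all0? (u ∘ suc)
  ... | no u₀ | _ = inj₂ (zero , u₀)
  ... | yes _ | inj₂ (k , uk) = inj₂ (suc k , uk)
  ... | yes u₀ | inj₁ h = inj₁ λ { zero → u₀ ; (suc k) → h k }

  -- Gaussian elimination on the list. A vector v already spanned by the rest changes nothing;
  -- otherwise some y₀ kills the rest but not v, and serves as a pivot for correcting both u and the
  -- separating functional.
  fredholm : ∀ {n} (vs : List (Fin n → ℚ)) u → Span vs u ⊎ ∃ λ y → Kills y vs × y ∙ u ≢ 0ℚ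
  fredholm [] u with all0? u
  ... | inj₁ u≡0 = inj₁ u≡0
  ... | inj₂ (x , ux≢0) = inj₂ (δ x , [] , λ e → ux≢0 (trans (sym (∙-δ u x))
          (trans (ℚΣ.sum-cong-≗ (λ k → ℚₚ.*-comm (u k) (δ x k))) e)))
  fredholm (v ∷ vs) u with fredholm vs v
  ... | inj₁ v∈ = result
    where
    open +-*-Solver
    result : Span (v ∷ vs) u ⊎ ∃ λ y → Kills y (v ∷ vs) × y ∙ u ≢ 0ℚ
    result with fredholm vs u
    ... | inj₂ (y , yvs , yu) = inj₂ (y , (Span⊆Kills y vs v yvs v∈ ∷ yvs) , yu)
    ... | inj₁ u∈ = inj₁ (0ℚ , Span-resp vs (λ k → solve 2 (λ a b → a := a :- con 0ℚ :* b) refl (u k) (v k)) u∈)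
  ... | inj₂ (y₀ , y₀vs , y₀v≢0) = result
    where
    instance nz : ℚ.NonZero (y₀ ∙ v)
             nz = ℚ.≢-nonZero y₀v≢0
    r = ℚ.1/ (y₀ ∙ v)
    -- Chosen so that `y₀` kills u - q v.
    q = (y₀ ∙ u) ℚ.* r
    open ≡-Reasoning
    open +-*-Solver
    result : Span (v ∷ vs) u ⊎ ∃ λ y → Kills y (v ∷ vs) × y ∙ u ≢ 0ℚ
    result with fredholm vs (λ k → u k ℚ.- q ℚ.* v k)
    ... | inj₁ s = inj₁ (q , s)
    ... | inj₂ (y , yvs , yu′) = inj₂ (y′ , (y′v ∷ All.zipWith y′w (yvs , y₀vs)) , λ e → yu′
        (trans (∙-linearʳ y u v q) (trans (trans
            (solve 4 (λ a b c r → a :- (b :* r) :* c := a :- (c :* r) :* b) refl (y ∙ u) (y₀ ∙ u) (y ∙ v) r)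
                (sym (∙-linearˡ y y₀ u t))) e)))
      where
      -- Subtracting t y₀ from y kills v. Since t (y₀ ∙ u) = q (y ∙ v), the result takes on u the
      -- value of y on u - q v, which is nonzero.
      t = (y ∙ v) ℚ.* r
      y′ : Fin _ → ℚ
      y′ k = y k ℚ.- t ℚ.* y₀ k
      y′v : y′ ∙ v ≡ 0ℚ
      y′v = begin
        y′ ∙ v                                          ≡⟨ ∙-linearˡ y y₀ v t ⟩
        y ∙ v ℚ.- ((y ∙ v) ℚ.* r) ℚ.* (y₀ ∙ v)
          ≡⟨ solve 3 (λ a r b → a :- (a :* r) :* b := a :* (con 1ℚ :- r :* b)) refl (y ∙ v) r (y₀ ∙ v) ⟩
        (y ∙ v) ℚ.* (1ℚ ℚ.- r ℚ.* (y₀ ∙ v))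
          ≡⟨ cong (λ z → (y ∙ v) ℚ.* (1ℚ ℚ.- z)) (ℚₚ.*-inverseˡ (y₀ ∙ v)) ⟩
        (y ∙ v) ℚ.* 0ℚ                                  ≡⟨ ℚₚ.*-zeroʳ (y ∙ v) ⟩
        0ℚ                                              ∎
      y′w : ∀ {w} → y ∙ w ≡ 0ℚ × y₀ ∙ w ≡ 0ℚ → y′ ∙ w ≡ 0ℚ
      y′w {w} (a , b) = trans (∙-linearˡ y y₀ w t)
          (trans (cong₂ (λ a b → a ℚ.- t ℚ.* b) a b) (trans (ℚₚ.+-identityˡ _) (cong ℚ.-_ (ℚₚ.*-zeroʳ t))))

  -- Duality of matroids of orthogonal spaces

  private
    variable
      a ℓ ℓ′ : Level
      n : ℕ

  IsBasis-resp : ∀ {E : Set a} {Ind : (E → Bool) → Set ℓ} {B B′ : E → Bool} → (∀ e → B e ≡ B′ e) →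
    (∀ {S S′} → (∀ e → S e ≡ S′ e) → Ind S → Ind S′) → IsBasis Ind B → IsBasis Ind B′
  IsBasis-resp B≗B′ resp (ind , maximal) = resp B≗B′ ind , λ S indS B′⊆S e Se →
    trans (sym (B≗B′ e)) (maximal S indS (λ e Be → B′⊆S e (trans (sym (B≗B′ e)) Be)) e Se)

  -- `P` is to be read as the space of linear relations among the vectors representing the matroid.
  Indep : ((Fin n → ℚ) → Set ℓ) → (Fin n → Bool) → Set ℓ
  Indep P S = ∀ c → (∀ k → S k ≡ false → c k ≡ 0ℚ) → P c → ∀ k → c k ≡ 0ℚ

  Indep-resp : ∀ {P : (Fin n → ℚ) → Set ℓ} {S S′} → (∀ k → S k ≡ S′ k) → Indep P S → Indep P S′
  Indep-resp S≗S′ ind c supp = ind c (λ k Sk → supp k (trans (sym (S≗S′ k)) Sk))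

  Orthogonal : ((Fin n → ℚ) → Set ℓ) → ((Fin n → ℚ) → Set ℓ′) → Set (ℓ ⊔ ℓ′)
  Orthogonal P Q = ∀ c z → P c → Q z → c ∙ z ≡ 0ℚ

  -- P is as large as its orthogonality to Q allows: δ x is either in P up to a vector
  -- supported on T, or separated from P and T by a vector of Q.
  Alternative : ((Fin n → ℚ) → Set ℓ) → ((Fin n → ℚ) → Set ℓ′) → Set (ℓ ⊔ ℓ′)
  Alternative {n} P Q = ∀ (T : Fin n → Bool) (x : Fin n) → T x ≡ false →
    (∃ λ d → P d × d x ≢ 0ℚ × (∀ k → T k ≡ false → k ≢ x → d k ≡ 0ℚ)) ⊎
    (∃ λ z → Q z × z x ≢ 0ℚ × (∀ k → T k ≡ true → z k ≡ 0ℚ))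

  Orthogonal-sym : ∀ {P : (Fin n → ℚ) → Set ℓ} {Q : (Fin n → ℚ) → Set ℓ′} → Orthogonal P Q → Orthogonal Q P
  Orthogonal-sym orth z c Qz Pc = trans (ℚΣ.sum-cong-≗ λ k → ℚₚ.*-comm (z k) (c k)) (orth c z Pc Qz)

  _∖_ : (Fin n → Bool) → Fin n → Fin n → Bool
  (T ∖ x) k = T k ∧ not (does (k Fin.≟ x))

  ∖-same : ∀ (T : Fin n → Bool) x → (T ∖ x) x ≡ false
  ∖-same T x with T x | x Fin.≟ x
  ... | false | _       = refl
  ... | true  | yes _   = refl
  ... | true  | no x≢x  = contradiction refl x≢x

  ∖-other : ∀ (T : Fin n → Bool) {x k} → k ≢ x → (T ∖ x) k ≡ T k
  ∖-other T {x} {k} k≢x with T k | k Fin.≟ x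
  ... | false | _       = refl
  ... | true  | yes k≡x = contradiction k≡x k≢x
  ... | true  | no _    = refl

  -- The two horns trade places when T is replaced by the complement of T with x removed.
  Alternative-sym : ∀ {P : (Fin n → ℚ) → Set ℓ} {Q : (Fin n → ℚ) → Set ℓ′} → Alternative P Q → Alternative Q P
  Alternative-sym alt T x Tx with alt ((not ∘ T) ∖ x) x (∖-same (not ∘ T) x)
  ... | inj₁ (d , Pd , dx , d≡0) = inj₂
      (d , Pd , dx , λ k Tk → d≡0 k (T⇒ k Tk) λ { refl → contradiction (trans (sym Tk) Tx) λ () })
    where
    T⇒ : ∀ k → T k ≡ true → ((not ∘ T) ∖ x) k ≡ false
    T⇒ k Tk rewrite Tk = refl
  ... | inj₂ (z , Qz , zx , z≡0) = inj₁ (z , Qz , zx , λ k Tk k≢x → z≡0 k (trans (∖-other (not ∘ T) k≢x) (cong not Tk)))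

  module _ {P : (Fin n → ℚ) → Set ℓ} {Q : (Fin n → ℚ) → Set ℓ′}
           (orth : Orthogonal P Q) (alt : Alternative P Q) where

    private
      insert : (Fin n → Bool) → Fin n → Fin n → Bool
      insert B x = not ∘ ((not ∘ B) ∖ x)

      ⊆insert : ∀ B x k → B k ≡ true → insert B x k ≡ true
      ⊆insert B x k Bk rewrite Bk = refl

      x∈insert : ∀ B x → insert B x x ≡ true
      x∈insert B x = cong not (∖-same (not ∘ B) x)

      ∉insert : ∀ B x k → k ≢ x → B k ≡ false → insert B x k ≡ false
      ∉insert B x k k≢x Bk = cong not (trans (∖-other (not ∘ B) k≢x) (cong not Bk))

    -- Let z in Q vanish on B but not at some x outside B. A vector of P supported on B and x meets
    -- z only at x, so orthogonality makes it vanish there and independence of B makes it zero. Thus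
    -- x could be added to B, against maximality.
    complement-independent : ∀ {B} → IsBasis (Indep P) B → Indep Q (not ∘ B)
    complement-independent {B} (ind , maximal) z supp Qz x with B x in Bx
    ... | true  = supp x (cong not Bx)
    ... | false with z x ℚ.≟ 0ℚ
    ...   | yes zx≡0 = zx≡0
    ...   | no zx≢0 = contradiction (trans (sym Bx)
        (maximal (insert B x) insert-ind (⊆insert B x) x (x∈insert B x))) λ ()
      where
      insert-ind : Indep P (insert B x)
      insert-ind c c-supp Pc = ind c c-supp-B Pc
        where
        off-x : ∀ k → k ≢ x → z k ℚ.* c k ≡ 0ℚ
        off-x k k≢x with B k in Bk
        ... | true  = trans (cong (ℚ._* c k) (supp k (cong not Bk))) (ℚₚ.*-zeroˡ (c k))
        ... | false = trans (cong (z k ℚ.*_) (c-supp k (∉insert B x k k≢x Bk))) (ℚₚ.*-zeroʳ (z k))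
        cx≡0 : c x ≡ 0ℚ
        cx≡0 = *≡0⇒≡0 zx≢0 (trans (sym (∙-single z c x off-x)) (Orthogonal-sym orth z c Qz Pc))
        c-supp-B : ∀ k → B k ≡ false → c k ≡ 0ℚ
        c-supp-B k Bk with k Fin.≟ x
        ... | yes refl = cx≡0
        ... | no k≢x   = c-supp k (∉insert B x k k≢x Bk)

    -- If S also contained some x of B, the alternative for B without x would give either a vector
    -- of P supported on B or a vector of Q supported on S, nonzero at x in both cases. Each
    -- contradicts an independence.
    complement-maximal : ∀ {B} → Indep P B → ∀ S → Indep Q S → (∀ k → not (B k) ≡ true → S k ≡ true) →
      ∀ x → S x ≡ true → not (B x) ≡ true
    complement-maximal {B} ind S indS ⊆S x Sx with B x in Bx
    ... | false = refl
    ... | true with alt (B ∖ x) x (∖-same B x)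
    ...   | inj₁ (d , Pd , dx≢0 , d≡0) = contradiction (ind d supp Pd x) dx≢0
      where
      supp : ∀ k → B k ≡ false → d k ≡ 0ℚ
      supp k Bk = d≡0 k (trans (∖-other B k≢x) Bk) k≢x
        where
        k≢x : k ≢ x
        k≢x refl = contradiction (trans (sym Bk) Bx) λ ()
    ...   | inj₂ (z , Qz , zx≢0 , z≡0) = contradiction (indS z supp Qz x) zx≢0
      where
      supp : ∀ k → S k ≡ false → z k ≡ 0ℚ
      supp k Sk with B k in Bk
      ... | false = contradiction (trans (sym Sk) (⊆S k (cong not Bk))) λ ()
      ... | true  = z≡0 k (trans (∖-other B k≢x) Bk)
        where
        k≢x : k ≢ x
        k≢x refl = contradiction (trans (sym Sk) Sx) λ ()

    complement-basis : ∀ {B} → IsBasis (Indep P) B → IsBasis (Indep Q) (not ∘ B)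
    complement-basis basis@(ind , _) = complement-independent basis , complement-maximal ind

  complement-basis⁻ : ∀ {P : (Fin n → ℚ) → Set ℓ} {Q : (Fin n → ℚ) → Set ℓ′} → Orthogonal P Q → Alternative P Q →
    ∀ {B} → IsBasis (Indep Q) (not ∘ B) → IsBasis (Indep P) B
  complement-basis⁻ {P = P} orth alt {B} basis = IsBasis-resp (not-involutive ∘ B) (Indep-resp {P = P})
    (complement-basis (Orthogonal-sym orth) (Alternative-sym alt) basis)

  module _ {J : (Fin n → ℚ) → Set ℓ} (rows : List (Fin n → ℚ))
           (J-0 : ∀ {u} → (∀ k → u k ≡ 0ℚ) → J u)
           (J-+ : ∀ {u v w} q → J u → J v → (∀ k → w k ≡ u k ℚ.+ q ℚ.* v k) → J w)
           (rows⊆J : All J rows) where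

    private
      Span⊆J : ∀ {vs} → All J vs → ∀ {u} → Span vs u → J u
      Span⊆J []         s       = J-0 s
      Span⊆J {v ∷ _} (Jv ∷ Jvs) {u} (q , s) = J-+ q (Span⊆J Jvs s) Jv λ k →
        solve 3 (λ u q v → u := (u :- q :* v) :+ q :* v) refl (u k) q (v k)
        where open +-*-Solver

      -- Spans the coordinate subspace of T. Indices outside T give the zero vector, so that the
      -- generating list can run over all of `Fin n`.
      restricted : (Fin n → Bool) → Fin n → Fin n → ℚ
      restricted T b k = if T b then δ b k else 0ℚ

      restricted-off : ∀ T b k → T k ≡ false → restricted T b k ≡ 0ℚ
      restricted-off T b k Tk with T b in Tb
      ... | false = refl
      ... | true  = δ-other {x = b} {k} λ { refl → contradiction (trans (sym Tk) Tb) λ () }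

      restricted-kills : ∀ T z b → z ∙ restricted T b ≡ 0ℚ → T b ≡ true → z b ≡ 0ℚ
      restricted-kills T z b e Tb rewrite Tb = trans (sym (∙-δ z b)) e

      decompose : ∀ T bs u → Span (map (restricted T) bs ++ rows) u →
        ∃ λ d → J d × (∀ k → T k ≡ false → d k ≡ u k)
      decompose T [] u s = u , Span⊆J rows⊆J s , λ _ _ → refl
      decompose T (b ∷ bs) u (q , s) with decompose T bs _ s
      ... | d , Jd , d≡ = d , Jd , λ k Tk → trans (d≡ k Tk)
            (trans (cong (λ t → u k ℚ.- q ℚ.* t) (restricted-off T b k Tk))
              (solve 2 (λ u q → u :- q :* con 0ℚ := u) refl (u k) q))
        where open +-*-Solver

    -- The Fredholm alternative for `δ x` against the rows together with the coordinate vectors of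
    -- T. If `δ x` is spanned, removing the part on T leaves a vector of J that equals `δ x` off T;
    -- if not, the separating functional kills the rows and vanishes on T.
    span-alternative : Alternative J (λ z → Kills z rows)
    span-alternative T x Tx = Sum.map on-span separated (fredholm (map (restricted T) (allFin n) ++ rows) (δ x))
      where
      on-span : Span (map (restricted T) (allFin n) ++ rows) (δ x) →
        ∃ λ d → J d × d x ≢ 0ℚ × (∀ k → T k ≡ false → k ≢ x → d k ≡ 0ℚ)
      on-span s with decompose T (allFin n) (δ x) s
      ... | d , Jd , d≡ = d , Jd ,
            (λ dx≡0 → contradiction (trans (sym (δ-same x)) (trans (sym (d≡ x Tx)) dx≡0)) λ ()) ,
            λ k Tk k≢x → trans (d≡ k Tk) (δ-other k≢x)
      separated : (∃ λ z → Kills z (map (restricted T) (allFin n) ++ rows) × z ∙ δ x ≢ 0ℚ) →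
        ∃ λ z → Kills z rows × z x ≢ 0ℚ × (∀ k → T k ≡ true → z k ≡ 0ℚ)
      separated (z , kills , zδ≢0) = z , Allₚ.++⁻ʳ (map (restricted T) (allFin n)) kills ,
        (λ zx≡0 → zδ≢0 (trans (∙-δ z x) zx≡0)) ,
        λ k → restricted-kills T z k (All.lookup (Allₚ.++⁻ˡ (map (restricted T) (allFin n)) kills)
            (∈-map⁺ (restricted T) (∈-allFin k)))

-- Uniform bounds and denominators for finite families

bounded : ∀ m (f : Fin m → ℕ) → ∃ λ A → ∀ i → f i ℕ.≤ A
bounded zero    f = 0 , λ ()
bounded (suc m) f with bounded m (f ∘ suc)
... | A , f≤A = f zero ℕ.⊔ A , λ where
  zero    → ℕₚ.m≤m⊔n (f zero) A
  (suc i) → ℕₚ.≤-trans (f≤A i) (ℕₚ.m≤n⊔m (f zero) A)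

common-denominator₂ : ∀ m n (q : Fin m → Fin n → ℚ) →
  ∃ λ D → NonZero D × (∀ i j → IsInt (fromℕ D ℚ.* q i j))
common-denominator₂ m n q with common-denominator (m ℕ.* n) (uncurry q ∘ remQuot n)
... | D , D≢0 , int = D , D≢0 , λ i j →
  ≡.subst (λ ij → IsInt (fromℕ D ℚ.* uncurry q ij)) (Finₚ.remQuot-combine i j) (int (combine i j))

small-multiple≡0 : ∀ {p a b} → ℤ.∣ a ∣ ℕ.< p → a ≡ + p ℤ.* b → a ≡ + 0
small-multiple≡0 {p} {a} {b} a<p a≡pb with ℤ.∣ a ∣ in eq
... | zero  = ℤₚ.∣i∣≡0⇒i≡0 eq
... | suc k = contradiction (ℕᵈ.divides ℤ.∣ b ∣ (≡.trans (≡.sym eq)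
  (≡.trans (≡.cong ℤ.∣_∣ a≡pb) (≡.trans (ℤₚ.abs-* (+ p) b) (ℕₚ.*-comm p ℤ.∣ b ∣))))) (ℕᵈ.>⇒∤ a<p)

-- Fields containing ℚ

module Over {c ℓ} (K : ℚField c ℓ) where
  open ℚField K hiding (zero) public
  open RingMorphisms.IsRingHomomorphism ι-hom public
    using () renaming (+-homo to ι-+; *-homo to ι-*; -‿homo to ι-neg; 0#-homo to ι-0; 1#-homo to ι-1; ⟦⟧-cong to ι-cong)
  open import Relation.Binary.Reasoning.Setoid setoid public
  open import Algebra.Properties.Semiring.Exp semiring public
    using (_^_; ^-congˡ; ^-homo-*; ^-assocʳ)
  open import Algebra.Properties.Semiring.Mult semiring public
    using (×-congˡ; ×-assocˡ)
    renaming (_×_ to _·_)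
  open import Algebra.Properties.CommutativeMonoid.Sum +-commutativeMonoid public
    using (sum; ∑-distrib-+; ∑-comm; sum-permute; sum-init-last; sum-replicate-zero; sum-cong-≋; sum-replicate)
  open import Algebra.Properties.Semiring.Sum semiring public
    using (*-distribˡ-sum; *-distribʳ-sum)

  open FacetSum commutativeRing public

  private
    ι-morphism : ℚ-rawRing -Raw-AlmostCommutative⟶ fromCommutativeRing commutativeRing
    ι-morphism = record { ⟦_⟧ = ι ; +-homo = ι-+ ; *-homo = ι-* ; -‿homo = ι-neg ; 0-homo = ι-0 ; 1-homo = ι-1 }

    coefficient≟ : ∀ p q → Maybe (ι p ≈ ι q)
    coefficient≟ p q with p ℚ.≟ q
    ... | yes p≡q = just (ι-cong p≡q)
    ... | no _    = nothing

  module Solver = Algebra.Solver.Ring ℚ-rawRing (fromCommutativeRing commutativeRing) ι-morphism coefficient≟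

  -- A nonzero rational is a unit, and ι preserves units. This carries equations in K back to ℚ,
  -- where equality is decidable.
  ι≈0⇒≡0 : ∀ q → ι q ≈ 0# → q ≡ 0ℚ
  ι≈0⇒≡0 q ιq≈0 with q ℚ.≟ 0ℚ
  ... | yes q≡0 = q≡0
  ... | no q≢0 = contradiction (begin
        1#                       ≈⟨ ι-1 ⟨
        ι 1ℚ                     ≈⟨ ι-cong (ℚₚ.*-inverseʳ q) ⟨
        ι (q ℚ.* ℚ.1/ q)         ≈⟨ ι-* q (ℚ.1/ q) ⟩
        ι q * ι (ℚ.1/ q)         ≈⟨ *-congʳ ιq≈0 ⟩
        0# * ι (ℚ.1/ q)          ≈⟨ zeroˡ _ ⟩
        0#                       ∎) 1≉0
    where
    instance
      q-nonZero : ℚ.NonZero q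
      q-nonZero = ℚ.≢-nonZero q≢0

  *≈0⇒≈0 : ∀ {x y} → ¬ (x ≈ 0#) → x * y ≈ 0# → y ≈ 0#
  *≈0⇒≈0 {x} {y} x≉0 xy≈0 with inverse x x≉0
  ... | x⁻¹ , xx⁻¹≈1 = begin
    y              ≈⟨ *-identityˡ y ⟨
    1# * y         ≈⟨ *-congʳ xx⁻¹≈1 ⟨
    x * x⁻¹ * y    ≈⟨ solve 3 (λ x i y → x :* i :* y := i :* (x :* y)) refl x x⁻¹ y ⟩
    x⁻¹ * (x * y)  ≈⟨ *-congˡ xy≈0 ⟩
    x⁻¹ * 0#       ≈⟨ zeroʳ x⁻¹ ⟩
    0#             ∎
    where open Solver

  ι*≈0⇒≈0 : ∀ {q x} → q ≢ 0ℚ → ι q * x ≈ 0# → x ≈ 0#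
  ι*≈0⇒≈0 {q} q≢0 = *≈0⇒≈0 λ ιq≈0 → q≢0 (ι≈0⇒≡0 q ιq≈0)

  ·≈ι* : ∀ m x → m · x ≈ ι (fromℕ m) * x
  ·≈ι* zero x = sym (trans (*-congʳ ι-0) (zeroˡ x))
  ·≈ι* (suc m) x = begin
    x + m · x                      ≈⟨ +-congˡ (·≈ι* m x) ⟩
    x + ι (fromℕ m) * x            ≈⟨ solve 2 (λ x q → x :+ q :* x := (con 1ℚ :+ q) :* x) refl x (ι (fromℕ m)) ⟩
    (ι 1ℚ + ι (fromℕ m)) * x       ≈⟨ *-congʳ (ι-+ 1ℚ (fromℕ m)) ⟨
    ι (1ℚ ℚ.+ fromℕ m) * x         ≈⟨ *-congʳ (ι-cong (fromℕ-suc m)) ⟨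
    ι (fromℕ (suc m)) * x          ∎
    where open Solver

  sum≈0 : ∀ {n} {f : Fin n → Carrier} → (∀ i → f i ≈ 0#) → sum f ≈ 0#
  sum≈0 {n} f≈0 = trans (sum-cong-≋ f≈0) (sum-replicate-zero n)

  RootOfUnity : ℕ → Carrier → Set ℓ
  RootOfUnity n x = x ^ n ≈ 1#

  OrderAtLeast : ℕ → Carrier → Set ℓ
  OrderAtLeast n x = ∀ k → 0 ℕ.< k → k ℕ.< n → ¬ (x ^ k ≈ 1#)

  1^ : ∀ m → 1# ^ m ≈ 1#
  1^ zero    = refl
  1^ (suc m) = trans (*-identityˡ _) (1^ m)

  geometric : ∀ x m → (x - 1#) * sum {m} (λ k → x ^ toℕ k) ≈ x ^ m - 1#
  geometric x zero = trans (zeroʳ _) (sym (-‿inverseʳ 1#))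
  geometric x (suc m) = begin
    (x - 1#) * (1# + sum {m} (λ k → x * x ^ toℕ k))
      ≈⟨ *-congˡ (+-congˡ (sym (*-distribˡ-sum {m} x (λ k → x ^ toℕ k)))) ⟩
    (x - 1#) * (1# + x * G)
      ≈⟨ solve 3 (λ x o g → (x :- o) :* (o :+ x :* g) := (x :- o) :* o :+ x :* ((x :- o) :* g)) refl x 1# G ⟩
    (x - 1#) * 1# + x * ((x - 1#) * G)     ≈⟨ +-cong (*-identityʳ _) (*-congˡ (geometric x m)) ⟩
    x - 1# + x * (x ^ m - 1#)
      ≈⟨ solve 3 (λ x o y → x :- o :+ x :* (y :- o) := x :* y :- o :+ (x :- x :* o)) refl x 1# (x ^ m) ⟩
    x * x ^ m - 1# + (x - x * 1#)          ≈⟨ +-congˡ (trans (+-congˡ (-‿cong (*-identityʳ x))) (-‿inverseʳ x)) ⟩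
    x * x ^ m - 1# + 0#                    ≈⟨ +-identityʳ _ ⟩
    x ^ suc m - 1#                         ∎
    where
    open Solver
    G = sum {m} (λ k → x ^ toℕ k)

  sum-of-powers≈0 : ∀ {x} m → x ^ m ≈ 1# → ¬ (x ≈ 1#) → sum {m} (λ k → x ^ toℕ k) ≈ 0#
  sum-of-powers≈0 {x} m x^m≈1 x≉1 = *≈0⇒≈0 x-1≉0 (trans (geometric x m) (trans (+-congʳ x^m≈1) (-‿inverseʳ 1#)))
    where
    open Solver
    x-1≉0 : ¬ (x - 1# ≈ 0#)
    x-1≉0 e = x≉1 (trans (solve 2 (λ x o → x := x :- o :+ o) refl x 1#) (trans (+-congʳ e) (+-identityˡ 1#)))

  *-cancelˡ : ∀ {x y z} → ¬ (x ≈ 0#) → x * y ≈ x * z → y ≈ z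
  *-cancelˡ {x} {y} {z} x≉0 e = begin
    y            ≈⟨ solve 2 (λ y z → y := z :+ (y :- z)) refl y z ⟩
    z + (y - z)  ≈⟨ +-congˡ (*≈0⇒≈0 x≉0 (trans (solve 3 (λ x y z → x :* (y :- z) := x :* y :- x :* z) refl x y z)
                      (trans (+-congʳ e) (-‿inverseʳ _)))) ⟩
    z + 0#       ≈⟨ +-identityʳ z ⟩
    z            ∎
    where open Solver

  ι-sum : ∀ {m} (h : Fin m → ℚ) → ι (ℚΣ.sum h) ≈ sum (ι ∘ h)
  ι-sum {zero}  h = ι-0
  ι-sum {suc m} h = trans (ι-+ (h zero) _) (+-congˡ (ι-sum (h ∘ suc)))

  comb : ∀ {d} → (Fin d → ℚ) → (Fin d → Carrier) → Carrier
  comb q w = sum (λ i → ι (q i) * w i)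

  comb-≡0 : ∀ {d} (q : Fin d → ℚ) w → (∀ i → q i ≡ 0ℚ) → comb q w ≈ 0#
  comb-≡0 {d} q w q≡0 = sum≈0 (λ i → trans (*-congʳ (trans (ι-cong (q≡0 i)) ι-0)) (zeroˡ _))

  comb-+ : ∀ {d} (q q′ : Fin d → ℚ) w → comb (λ i → q i ℚ.+ q′ i) w ≈ comb q w + comb q′ w
  comb-+ {d} q q′ w = trans (sum-cong-≋ (λ i → trans (*-congʳ (ι-+ (q i) (q′ i))) (distribʳ (w i) _ _)))
    (∑-distrib-+ (λ i → ι (q i) * w i) (λ i → ι (q′ i) * w i))

  comb-scale : ∀ {d} a (q : Fin d → ℚ) w → comb (λ i → a ℚ.* q i) w ≈ ι a * comb q w
  comb-scale {d} a q w = trans (sum-cong-≋ (λ i → trans (*-congʳ (ι-* a (q i))) (*-assoc _ _ _)))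
    (sym (*-distribˡ-sum (ι a) (λ i → ι (q i) * w i)))

  Coordinates : ∀ {d} → (Fin d → Carrier) → Carrier → Set ℓ
  Coordinates w x = ∃ λ q → x ≈ comb q w

  Independent : ∀ {d} → (Fin d → Carrier) → Set ℓ
  Independent w = ∀ q → comb q w ≈ 0# → ∀ i → q i ≡ 0ℚ

  -- Equality in K is not decidable, so a basis can only be found up to double negation.
  basis : (v : ℕ → Carrier) (m : ℕ) →
    ¬ ¬ (∃ λ d → Σ (Fin d → Carrier) λ w → Independent w × (∀ j → j ℕ.< m → Coordinates w (v j)))
  basis v zero none = none (0 , (λ ()) , (λ _ _ ()) , λ _ ())
  basis v (suc m) none = basis v m λ where
      (d , w , indep , coords) →
        let
          v∉ : ¬ Coordinates w (v m)
          v∉ v∈ = none (d , w , indep , λ j j<1+m → extend coords v∈ (ℕₚ.m≤n⇒m<n∨m≡n (ℕ.s≤s⁻¹ j<1+m)))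
          w′ = cons (v m) w
        in none (suc d , w′ , extend-indep indep v∉ , λ j j<1+m →
              extend {w = w′} (λ j j<m → weaken (coords j j<m)) head-coordinates (ℕₚ.m≤n⇒m<n∨m≡n (ℕ.s≤s⁻¹ j<1+m)))
    where
    cons : ∀ {d} → Carrier → (Fin d → Carrier) → Fin (suc d) → Carrier
    cons x w zero    = x
    cons x w (suc i) = w i

    extend : ∀ {d} {w : Fin d → Carrier} → (∀ j → j ℕ.< m → Coordinates w (v j)) →
      Coordinates w (v m) → ∀ {j} → j ℕ.< m ⊎ j ≡ m → Coordinates w (v j)
    extend coords v∈ (inj₁ j<m)    = coords _ j<m
    extend coords v∈ (inj₂ ≡.refl) = v∈

    weaken : ∀ {d x y} {w : Fin d → Carrier} → Coordinates w x → Coordinates (cons y w) x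
    weaken {y = y} (q , x≈) = (λ { zero → 0ℚ ; (suc i) → q i }) ,
      trans x≈ (sym (trans (+-congʳ (trans (*-congʳ ι-0) (zeroˡ y))) (+-identityˡ _)))

    head-coordinates : ∀ {d x} {w : Fin d → Carrier} → Coordinates (cons x w) x
    head-coordinates {x = x} {w} = (λ { zero → 1ℚ ; (suc i) → 0ℚ }) ,
      sym (trans (+-cong (trans (*-congʳ ι-1) (*-identityˡ x)) (comb-≡0 _ w λ _ → ≡.refl)) (+-identityʳ x))

    extend-indep : ∀ {d x} {w : Fin d → Carrier} → Independent w → ¬ Coordinates w x → Independent (cons x w)
    extend-indep {x = x} {w} indep x∉ q q≈0 with q zero ℚ.≟ 0ℚ
    ... | no q₀≢0 = contradiction ((λ i → ℚ.- ℚ.1/ q zero ℚ.* q (suc i)) , (begin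
            x                                            ≈⟨ *-identityˡ x ⟨
            1# * x
              ≈⟨ *-congʳ (trans (sym ι-1) (trans (ι-cong (≡.sym (ℚₚ.*-inverseˡ (q zero))))
                  (ι-* (ℚ.1/ q zero) (q zero)))) ⟩
            ι (ℚ.1/ q zero) * ι (q zero) * x
              ≈⟨ solve 4 (λ r a x s → r :* a :* x := r :* (a :* x :+ s) :+ (:- r) :* s) refl (ι (ℚ.1/ q zero))
                  (ι (q zero)) x (comb (q ∘ suc) w) ⟩
            ι (ℚ.1/ q zero) * (ι (q zero) * x + comb (q ∘ suc) w) + - ι (ℚ.1/ q zero) * comb (q ∘ suc) w
                                                         ≈⟨ +-cong (trans (*-congˡ q≈0) (zeroʳ _))
                                                             (*-congʳ (sym (ι-neg (ℚ.1/ q zero)))) ⟩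
            0# + ι (ℚ.- ℚ.1/ q zero) * comb (q ∘ suc) w
              ≈⟨ trans (+-identityˡ _) (sym (comb-scale (ℚ.- ℚ.1/ q zero) (q ∘ suc) w)) ⟩
            comb (λ i → ℚ.- ℚ.1/ q zero ℚ.* q (suc i)) w ∎)) x∉
      where
      open Solver
      instance
        q₀-nonZero : ℚ.NonZero (q zero)
        q₀-nonZero = ℚ.≢-nonZero q₀≢0
    ... | yes q₀≡0 = λ where
            zero    → q₀≡0
            (suc i) → indep (q ∘ suc) (trans (sym
                (trans (+-congʳ (trans (*-congʳ (trans (ι-cong q₀≡0) ι-0)) (zeroˡ x))) (+-identityˡ _))) q≈0) i

-- Vanishing at the conjugates of ζ

module Conjugation {c ℓ} (K : ℚField c ℓ) where
  open Over K
  open import Algebra.Properties.CommutativeSemiring.Binomial commutativeSemiring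
    using (binomialTerm) renaming (theorem to binomial-theorem)

  ≈0⇒^≈0 : ∀ m .{{_ : NonZero m}} {x} → x ≈ 0# → x ^ m ≈ 0#
  ≈0⇒^≈0 (suc m) x≈0 = trans (*-congʳ x≈0) (zeroˡ _)

  -- The subring generated by ζ, built from its powers by addition and negation only. Integral
  -- coordinates can then be computed by recursion, without a clause for products.
  data ℤ[_] (ζ : Carrier) (x : Carrier) : Set (c ⊔ ℓ) where
    power : ∀ j → x ≈ ζ ^ j → ℤ[ ζ ] x
    plus  : ∀ {y z} → ℤ[ ζ ] y → ℤ[ ζ ] z → x ≈ y + z → ℤ[ ζ ] x
    minus : ∀ {y} → ℤ[ ζ ] y → x ≈ - y → ℤ[ ζ ] x

  module _ {ζ : Carrier} where
    ℤ[]-1 : ℤ[ ζ ] 1#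
    ℤ[]-1 = power 0 refl

    ℤ[]-0 : ℤ[ ζ ] 0#
    ℤ[]-0 = plus ℤ[]-1 (minus ℤ[]-1 refl) (sym (-‿inverseʳ 1#))

    ℤ[]-* : ∀ {x y} → ℤ[ ζ ] x → ℤ[ ζ ] y → ℤ[ ζ ] (x * y)
    ℤ[]-* (power i e) (power j e′) = power (i ℕ.+ j) (trans (*-cong e e′) (sym (^-homo-* ζ i j)))
    ℤ[]-* x∈@(power _ _) (plus a b e) = plus (ℤ[]-* x∈ a) (ℤ[]-* x∈ b) (trans (*-congˡ e) (distribˡ _ _ _))
    ℤ[]-* x∈@(power _ _) (minus a e) = minus (ℤ[]-* x∈ a)
      (trans (*-congˡ e) (solve 2 (λ x y → x :* :- y := :- (x :* y)) refl _ _))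
      where open Solver
    ℤ[]-* (plus a b e) y∈ = plus (ℤ[]-* a y∈) (ℤ[]-* b y∈) (trans (*-congʳ e) (distribʳ _ _ _))
    ℤ[]-* (minus a e) y∈ = minus (ℤ[]-* a y∈)
      (trans (*-congʳ e) (solve 2 (λ x y → (:- x) :* y := :- (x :* y)) refl _ _))
      where open Solver

    ℤ[]-^ : ∀ {x} k → ℤ[ ζ ] x → ℤ[ ζ ] (x ^ k)
    ℤ[]-^ zero    x∈ = ℤ[]-1
    ℤ[]-^ (suc k) x∈ = ℤ[]-* x∈ (ℤ[]-^ k x∈)

    ℤ[]-· : ∀ {x} m → ℤ[ ζ ] x → ℤ[ ζ ] (m · x)
    ℤ[]-· zero    x∈ = ℤ[]-0
    ℤ[]-· (suc m) x∈ = plus x∈ (ℤ[]-· m x∈) refl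

    sum-multiples : ∀ p {m} (f : Fin m → Carrier) → (∀ i → ∃ λ z → ℤ[ ζ ] z × f i ≈ p · z) →
      ∃ λ z → ℤ[ ζ ] z × sum f ≈ p · z
    sum-multiples p {zero} f h = 0# , ℤ[]-0 , sym (p·0 p)
      where
      p·0 : ∀ p → p · 0# ≈ 0#
      p·0 zero    = refl
      p·0 (suc p) = trans (+-identityˡ _) (p·0 p)
    sum-multiples p {suc m} f h with h zero | sum-multiples p (f ∘ suc) (h ∘ suc)
    ... | z , z∈ , e | z′ , z′∈ , e′ = z + z′ , plus z∈ z′∈ refl , trans (+-cong e e′) (sym (·-+ p z z′))
      where
      ·-+ : ∀ p x y → p · (x + y) ≈ p · x + p · y
      ·-+ p x y = trans (·≈ι* p (x + y)) (trans (distribˡ _ x y) (sym (+-cong (·≈ι* p x) (·≈ι* p y))))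

    -- The inner binomial coefficients are multiples of p. In a field of characteristic 0 every
    -- element is p times another, so the content lies in z staying inside ℤ[ζ].
    freshman's-dream : ∀ {p} → Prime p → ∀ {x y} → ℤ[ ζ ] x → ℤ[ ζ ] y →
      ∃ λ z → ℤ[ ζ ] z × (x + y) ^ p ≈ x ^ p + y ^ p + p · z
    freshman's-dream {p} p-prime {x} {y} x∈ y∈ with p | p-prime
    ... | zero  | 0-prime = contradiction (prime⇒nonZero 0-prime) λ ()
    ... | p@(suc p′) | p-prime with sum-multiples p (λ i → binomialTerm x y p (suc (inject₁ i))) middle
      where
      middle : ∀ i → ∃ λ z → ℤ[ ζ ] z × binomialTerm x y p (suc (inject₁ {p′} i)) ≈ p · z
      middle i with prime∣binomial p-prime (ℕ.s≤s ℕ.z≤n)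
                      (ℕ.s≤s (≡.subst (ℕ._< p′) (≡.sym (Finₚ.toℕ-inject₁ i)) (Finₚ.toℕ<n i)))
      ... | ℕᵈ.divides q C≡q*p = q · t , ℤ[]-· q (ℤ[]-* (ℤ[]-^ k x∈) (ℤ[]-^ (p ℕ.∸ k) y∈)) ,
            trans (×-congˡ (≡.trans C≡q*p (ℕₚ.*-comm q p))) (sym (×-assocˡ t p q))
        where
        k = suc (toℕ (inject₁ i))
        t = x ^ k * y ^ (p ℕ.∸ k)
    ... | z , z∈ , middle≈ = z , z∈ , (begin
      (x + y) ^ p                           ≈⟨ binomial-theorem p x y ⟩
      term zero + sum (term ∘ suc)          ≈⟨ +-congˡ (sum-init-last (term ∘ suc)) ⟩
      term zero + (sum (term ∘ suc ∘ inject₁) + term (suc (Fin.fromℕ p′)))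
        ≈⟨ +-cong first (+-cong middle≈ last) ⟩
      y ^ p + (p · z + x ^ p)
        ≈⟨ solve 3 (λ y z x → y :+ (z :+ x) := x :+ y :+ z) refl (y ^ p) (p · z) (x ^ p) ⟩
      x ^ p + y ^ p + p · z                 ∎)
      where
      open Solver
      term = binomialTerm x y p
      first : term zero ≈ y ^ p
      first = trans (+-identityʳ _) (*-identityˡ _)
      last : term (suc (Fin.fromℕ p′)) ≈ x ^ p
      last = begin
        (p C suc (toℕ (Fin.fromℕ p′))) · (x ^ suc (toℕ (Fin.fromℕ p′)) * y ^ (p ℕ.∸ suc (toℕ (Fin.fromℕ p′))))
          ≡⟨ ≡.cong (λ k → (p C suc k) · (x ^ suc k * y ^ (p ℕ.∸ suc k))) (Finₚ.toℕ-fromℕ p′) ⟩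
        (p C p) · (x ^ p * y ^ (p ℕ.∸ p))   ≡⟨ ≡.cong₂ (λ a b → a · (x ^ p * y ^ b)) (nCn≡1 p) (ℕₚ.n∸n≡0 p) ⟩
        x ^ p * 1# + 0#                     ≈⟨ trans (+-identityʳ _) (*-identityʳ _) ⟩
        x ^ p                               ∎

  -- The sequences k ↦ f (ζᵏ) for an integral polynomial f.
  data Evaluations (ζ : Carrier) (X : ℕ → Carrier) : Set (c ⊔ ℓ) where
    power : ∀ j → (∀ k → X k ≈ ζ ^ (k ℕ.* j)) → Evaluations ζ X
    plus  : ∀ {Y Z} → Evaluations ζ Y → Evaluations ζ Z → (∀ k → X k ≈ Y k + Z k) → Evaluations ζ X
    minus : ∀ {Y} → Evaluations ζ Y → (∀ k → X k ≈ - Y k) → Evaluations ζ X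

  module _ {ζ : Carrier} where
    Evaluations-resp : ∀ {X Y} → (∀ k → Y k ≈ X k) → Evaluations ζ X → Evaluations ζ Y
    Evaluations-resp e (power j h)  = power j (λ k → trans (e k) (h k))
    Evaluations-resp e (plus a b h) = plus a b (λ k → trans (e k) (h k))
    Evaluations-resp e (minus a h)  = minus a (λ k → trans (e k) (h k))

    Evaluations-0 : Evaluations ζ (λ _ → 0#)
    Evaluations-0 = plus (power 0 (λ _ → refl)) (minus (power 0 (λ _ → refl)) (λ _ → refl))
      (λ k → sym (-‿inverseʳ _))

    Evaluations-· : ∀ {X} m → Evaluations ζ X → Evaluations ζ (λ k → m · X k)
    Evaluations-· zero    a = Evaluations-0
    Evaluations-· (suc m) a = plus a (Evaluations-· m a) (λ _ → refl)

    Evaluations-scale : ∀ {X} z → Evaluations ζ X → Evaluations ζ (λ k → ι (fromℤ z) * X k)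
    Evaluations-scale (+ m)    a = Evaluations-resp (λ k → sym (·≈ι* m _)) (Evaluations-· m a)
    Evaluations-scale -[1+ m ] a = minus (Evaluations-· (suc m) a) λ k → begin
      ι (fromℤ -[1+ m ]) * _               ≈⟨ *-congʳ (ι-cong (fromℤ-neg (+ suc m))) ⟩
      ι (ℚ.- fromℕ (suc m)) * _            ≈⟨ *-congʳ (ι-neg _) ⟩
      - ι (fromℕ (suc m)) * _              ≈⟨ solve 2 (λ x y → (:- x) :* y := :- (x :* y)) refl _ _ ⟩
      - (ι (fromℕ (suc m)) * _)            ≈⟨ -‿cong (·≈ι* (suc m) _) ⟨
      - (suc m · _)                        ∎
      where open Solver

    Evaluations-sum : ∀ {m} (X : Fin m → ℕ → Carrier) → (∀ i → Evaluations ζ (X i)) →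
      Evaluations ζ (λ k → sum (λ i → X i k))
    Evaluations-sum {zero}  X h = Evaluations-0
    Evaluations-sum {suc m} X h = plus (h zero) (Evaluations-sum (X ∘ suc) (h ∘ suc)) (λ _ → refl)

    Evaluations⊆ℤ[] : ∀ {X} → Evaluations ζ X → ∀ k → ℤ[ ζ ] (X k)
    Evaluations⊆ℤ[] (power j h)  k = power (k ℕ.* j) (h k)
    Evaluations⊆ℤ[] (plus a b h) k = plus (Evaluations⊆ℤ[] a k) (Evaluations⊆ℤ[] b k) (h k)
    Evaluations⊆ℤ[] (minus a h)  k = minus (Evaluations⊆ℤ[] a k) (h k)

    -- Induction on the construction of the polynomial: powers of ζ satisfy the formula exactly,
    -- with z = 0, and sums pick up the error of `freshman's-dream`. Integer coefficients are
    -- covered as repeated sums and negations.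
    frobenius : ∀ {p X} → Prime p → Evaluations ζ X → ∀ k →
      ∃ λ z → ℤ[ ζ ] z × X k ^ p ≈ X (k ℕ.* p) + p · z
    frobenius {p} {X} p-prime (power j h) k = 0# , ℤ[]-0 , (begin
      X k ^ p                ≈⟨ ^-congˡ p (h k) ⟩
      (ζ ^ (k ℕ.* j)) ^ p    ≈⟨ ^-assocʳ ζ (k ℕ.* j) p ⟩
      ζ ^ (k ℕ.* j ℕ.* p)
        ≡⟨ ≡.cong (ζ ^_) (≡.trans (ℕₚ.*-assoc k j p)
            (≡.trans (≡.cong (k ℕ.*_) (ℕₚ.*-comm j p)) (≡.sym (ℕₚ.*-assoc k p j)))) ⟩
      ζ ^ (k ℕ.* p ℕ.* j)    ≈⟨ h (k ℕ.* p) ⟨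
      X (k ℕ.* p)            ≈⟨ +-identityʳ _ ⟨
      X (k ℕ.* p) + 0#       ≈⟨ +-congˡ (trans (·≈ι* p 0#) (zeroʳ _)) ⟨
      X (k ℕ.* p) + p · 0#   ∎)
    frobenius {p} {X} p-prime (plus {Y} {Z} a b h) k
      with frobenius p-prime a k | frobenius p-prime b k
         | freshman's-dream p-prime (Evaluations⊆ℤ[] a k) (Evaluations⊆ℤ[] b k)
    ... | u , u∈ , eu | v , v∈ , ev | w , w∈ , ew = u + v + w , plus (plus u∈ v∈ refl) w∈ refl , (begin
      X k ^ p                                ≈⟨ trans (^-congˡ p (h k)) ew ⟩
      Y k ^ p + Z k ^ p + p · w
        ≈⟨ +-cong (+-cong (trans eu (+-congˡ (·≈ι* p u))) (trans ev (+-congˡ (·≈ι* p v)))) (·≈ι* p w) ⟩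
      Y (k ℕ.* p) + q * u + (Z (k ℕ.* p) + q * v) + q * w
        ≈⟨ solve 6 (λ y z q u v w → y :+ q :* u :+ (z :+ q :* v) :+ q :* w := y :+ z :+ q :* (u :+ v :+ w)) refl _ _
            q u v w ⟩
      Y (k ℕ.* p) + Z (k ℕ.* p) + q * (u + v + w) ≈⟨ +-cong (h (k ℕ.* p)) (·≈ι* p _) ⟨
      X (k ℕ.* p) + p · (u + v + w)          ∎)
      where
      open Solver
      q = ι (fromℕ p)
    -- (- y)ᵖ is read off from 0 = (y - y)ᵖ ≡ yᵖ + (- y)ᵖ, which treats p = 2 uniformly.
    frobenius {p} {X} p-prime (minus {Y} a h) k
      with frobenius p-prime a k
         | freshman's-dream p-prime (Evaluations⊆ℤ[] a k) (minus (Evaluations⊆ℤ[] a k) refl)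
    ... | u , u∈ , eu | w , w∈ , ew = - (u + w) , minus (plus u∈ w∈ refl) refl , (begin
      X k ^ p                                ≈⟨ ^-congˡ p (h k) ⟩
      (- Y k) ^ p
        ≈⟨ solve 4 (λ a b w q → b := :- a :+ (a :+ b :+ q :* w) :- q :* w) refl (Y k ^ p) ((- Y k) ^ p) w q ⟩
      - (Y k ^ p) + (Y k ^ p + (- Y k) ^ p + q * w) - q * w
        ≈⟨ +-congʳ (+-cong (-‿cong (trans eu (+-congˡ (·≈ι* p u))))
            (trans (+-congˡ (sym (·≈ι* p w))) (trans (sym ew) 0^p≈0))) ⟩
      - (Y (k ℕ.* p) + q * u) + 0# - q * w
        ≈⟨ trans (+-congʳ (+-identityʳ _)) (solve 4
            (λ y u w q → :- (y :+ q :* u) :- q :* w := :- y :+ q :* :- (u :+ w)) refl _ u w q) ⟩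
      - Y (k ℕ.* p) + q * - (u + w)          ≈⟨ +-cong (h (k ℕ.* p)) (·≈ι* p _) ⟨
      X (k ℕ.* p) + p · - (u + w)            ∎)
      where
      open Solver
      q = ι (fromℕ p)
      0^p≈0 : (Y k - Y k) ^ p ≈ 0#
      0^p≈0 = ≈0⇒^≈0 p {{prime⇒nonZero p-prime}} (-‿inverseʳ (Y k))

clear-multiple : ∀ D p {a b a′ b′} → D ℚ.* a ≡ fromℤ a′ → D ℚ.* b ≡ fromℤ b′ →
  a ℚ.+ (ℚ.- fromℕ p) ℚ.* b ≡ 0ℚ → a′ ≡ + p ℤ.* b′
clear-multiple D p {a} {b} {a′} {b′} Da Db a-pb≡0 = fromℤ-injective (begin
  fromℤ a′                                   ≡⟨ Da ⟨
  D ℚ.* a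
    ≡⟨ solve 4 (λ d a p b → d :* a := d :* (a :+ (:- p) :* b) :+ p :* (d :* b)) ≡.refl D a (fromℕ p) b ⟩
  D ℚ.* (a ℚ.+ (ℚ.- fromℕ p) ℚ.* b) ℚ.+ fromℕ p ℚ.* (D ℚ.* b)
    ≡⟨ ≡.cong₂ ℚ._+_ (≡.trans (≡.cong (D ℚ.*_) a-pb≡0) (ℚₚ.*-zeroʳ D)) (≡.cong (fromℕ p ℚ.*_) Db) ⟩
  0ℚ ℚ.+ fromℕ p ℚ.* fromℤ b′                ≡⟨ ≡.trans (ℚₚ.+-identityˡ _) (≡.sym (fromℤ-* (+ p) b′)) ⟩
  fromℤ (+ p ℤ.* b′)                         ∎)
  where
  open ≡.≡-Reasoning
  open Data.Rational.Solver.+-*-Solver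

module Landau {c ℓ} (K : ℚField c ℓ) (n : ℕ) .{{_ : NonZero n}} (ζ : ℚField.Carrier K)
  (ζ^n≈1 : Over.RootOfUnity K n ζ) where
  open Over K
  open Conjugation K

  ^-multiple : ∀ t → ζ ^ (n ℕ.* t) ≈ 1#
  ^-multiple t = trans (sym (^-assocʳ ζ n t)) (trans (^-congˡ t ζ^n≈1) (1^ t))

  ^-periodic : ∀ j t → ζ ^ (j ℕ.+ n ℕ.* t) ≈ ζ ^ j
  ^-periodic j t = trans (^-homo-* ζ j (n ℕ.* t)) (trans (*-congˡ (^-multiple t)) (*-identityʳ _))

  ^-% : ∀ j → ζ ^ j ≈ ζ ^ (j % n)
  ^-% j = trans (reflexive (≡.cong (ζ ^_) (≡.trans (m≡m%n+[m/n]*n j n) (≡.cong (j % n ℕ.+_) (ℕₚ.*-comm (j / n) n)))))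
    (^-periodic (j % n) (j / n))

  Evaluations-periodic : ∀ {X} → Evaluations ζ X → ∀ k t → X (k ℕ.+ n ℕ.* t) ≈ X k
  Evaluations-periodic (power j h) k t = begin
    _                                  ≈⟨ h (k ℕ.+ n ℕ.* t) ⟩
    ζ ^ ((k ℕ.+ n ℕ.* t) ℕ.* j)
      ≡⟨ ≡.cong (ζ ^_) (≡.trans (ℕₚ.*-distribʳ-+ j k (n ℕ.* t)) (≡.cong (k ℕ.* j ℕ.+_) (ℕₚ.*-assoc n t j))) ⟩
    ζ ^ (k ℕ.* j ℕ.+ n ℕ.* (t ℕ.* j))  ≈⟨ ^-periodic (k ℕ.* j) (t ℕ.* j) ⟩
    ζ ^ (k ℕ.* j)                      ≈⟨ h k ⟨
    _                                  ∎
  Evaluations-periodic (plus a b h) k t = trans (h (k ℕ.+ n ℕ.* t))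
    (trans (+-cong (Evaluations-periodic a k t) (Evaluations-periodic b k t)) (sym (h k)))
  Evaluations-periodic (minus a h) k t = trans (h (k ℕ.+ n ℕ.* t))
    (trans (-‿cong (Evaluations-periodic a k t)) (sym (h k)))

  Evaluations-% : ∀ {X} → Evaluations ζ X → ∀ m → X m ≈ X (m % n)
  Evaluations-% {X} a m = trans (reflexive
      (≡.cong X (≡.trans (m≡m%n+[m/n]*n m n) (≡.cong (m % n ℕ.+_) (ℕₚ.*-comm (m / n) n)))))
    (Evaluations-periodic a (m % n) (m / n))

  module _ {d} (w : Fin d → Carrier) (indep : Independent w)
           (coords : ∀ j → j ℕ.< n → Coordinates w (ζ ^ j)) where

    private
      q : Fin n → Fin d → ℚ
      q j = proj₁ (coords (toℕ j) (Finₚ.toℕ<n j))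

      common = common-denominator₂ n d q

      D : ℚ
      D = fromℕ (proj₁ common)

      D≢0 : D ≢ 0ℚ
      D≢0 = fromℕ≢0 (proj₁ common) {{proj₁ (proj₂ common)}}

    BoundedDenominator : Carrier → Set ℓ
    BoundedDenominator x = ∃ λ a → x ≈ comb a w × (∀ i → IsInt (D ℚ.* a i))

    -- Exponents reduce modulo n, so ℤ[ζ] is generated additively by n powers of ζ, and a
    -- denominator common to the coordinates of these serves every element.
    bounded-denominator : ∀ {x} → ℤ[ ζ ] x → BoundedDenominator x
    bounded-denominator {x} (power j e) = q j′ , x≈ , proj₂ (proj₂ common) j′
      where
      j′ = fromℕ< (m%n<n j n)
      x≈ : x ≈ comb (q j′) w
      x≈ = trans e (trans (^-% j) (trans (reflexive (≡.cong (ζ ^_) (≡.sym (Finₚ.toℕ-fromℕ< (m%n<n j n)))))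
             (proj₂ (coords (toℕ j′) (Finₚ.toℕ<n j′)))))
    bounded-denominator (plus y∈ z∈ e) with bounded-denominator y∈ | bounded-denominator z∈
    ... | a , y≈ , aℤ | b , z≈ , bℤ = (λ i → a i ℚ.+ b i) ,
      trans e (trans (+-cong y≈ z≈) (sym (comb-+ a b w))) ,
      λ i → ≡.subst IsInt (≡.sym (ℚₚ.*-distribˡ-+ D (a i) (b i))) (IsInt-+ (aℤ i) (bℤ i))
    bounded-denominator (minus y∈ e) with bounded-denominator y∈
    ... | a , y≈ , aℤ = (λ i → ℚ.- 1ℚ ℚ.* a i) ,
      trans e (trans (-‿cong y≈) (trans (solve 1 (λ y → :- y := con (ℚ.- 1ℚ) :* y) refl _)
          (sym (comb-scale (ℚ.- 1ℚ) a w)))) ,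
      λ i → ≡.subst IsInt (ℚS.solve 2 (λ d a → ℚS.:- (d ℚS.:* a) ℚS.:= d ℚS.:* (ℚS.con (ℚ.- 1ℚ) ℚS.:* a)) ≡.refl D
          (a i)) (IsInt-neg (aℤ i))
      where
      open Solver
      module ℚS = Data.Rational.Solver.+-*-Solver

    -- Independence turns x = p z into a = p b for each coordinate. After multiplication by D, an
    -- integer of absolute value below p is a multiple of p, hence zero.
    divisible⇒≈0 : ∀ {x z} (x∈ : BoundedDenominator x) p → ℤ[ ζ ] z → x ≈ p · z →
      (∀ i → ℤ.∣ proj₁ (proj₂ (proj₂ x∈) i) ∣ ℕ.< p) → x ≈ 0#
    divisible⇒≈0 {x} {z} (a , x≈ , aℤ) p z∈ x≈pz small with bounded-denominator z∈
    ... | b , z≈ , bℤ = trans x≈ (comb-≡0 a w a≡0)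
      where
      -p = ℚ.- fromℕ p
      difference : comb (λ i → a i ℚ.+ -p ℚ.* b i) w ≈ 0#
      difference = begin
        comb (λ i → a i ℚ.+ -p ℚ.* b i) w          ≈⟨ comb-+ a (λ i → -p ℚ.* b i) w ⟩
        comb a w + comb (λ i → -p ℚ.* b i) w
          ≈⟨ +-cong (sym x≈) (trans (comb-scale -p b w) (*-cong (ι-neg (fromℕ p)) (sym z≈))) ⟩
        x + - ι (fromℕ p) * z                      ≈⟨ +-congʳ (trans x≈pz (·≈ι* p z)) ⟩
        ι (fromℕ p) * z + - ι (fromℕ p) * z        ≈⟨ solve 2 (λ p z → p :* z :+ :- p :* z := con 0ℚ) refl _ _ ⟩
        ι 0ℚ                                       ≈⟨ ι-0 ⟩
        0#                                         ∎
        where open Solver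
      a≡0 : ∀ i → a i ≡ 0ℚ
      a≡0 i = *≡0⇒≡0 D≢0 (≡.trans (proj₂ (aℤ i)) (≡.cong fromℤ (small-multiple≡0 {b = proj₁ (bℤ i)} (small i)
        (clear-multiple D p {a i} {b i} (proj₂ (aℤ i)) (proj₂ (bℤ i)) (indep _ difference i)))))

    -- The sequence has period n, so only n values occur; A bounds their coordinates, scaled by D,
    -- for all m at once.
    large-primes : ∀ {X} → Evaluations ζ X → ∃ λ A → ∀ p → A ℕ.< p → ∀ m z → ℤ[ ζ ] z → X m ≈ p · z → X m ≈ 0#
    large-primes {X} a = proj₁ bound , λ p A<p m z z∈ X≈pz →
      let k = fromℕ< (m%n<n m n)
          X≈Xk : X m ≈ X (toℕ k)
          X≈Xk = trans (Evaluations-% a m) (reflexive (≡.cong X (≡.sym (Finₚ.toℕ-fromℕ< (m%n<n m n)))))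
      in trans X≈Xk (divisible⇒≈0 (integral k) p z∈ (trans (sym X≈Xk) X≈pz)
           (λ i → ℕₚ.≤-<-trans (≡.subst (λ ki → height ki ℕ.≤ proj₁ bound) (Finₚ.remQuot-combine k i)
               (proj₂ bound (combine k i))) A<p))
      where
      integral : ∀ k → BoundedDenominator (X (toℕ k))
      integral k = bounded-denominator (Evaluations⊆ℤ[] a (toℕ k))
      height : Fin n × Fin d → ℕ
      height (k , i) = ℤ.∣ proj₁ (proj₂ (proj₂ (integral k)) i) ∣
      bound = bounded (n ℕ.* d) (height ∘ remQuot d)

  -- Landau's argument: f (ζ) = 0 gives f (ζᵖ) ≡ f (ζ)ᵖ = 0 mod p, so f (ζᵖ) = 0 once p is large.
  conjugate : ∀ {X} → Evaluations ζ X → X 1 ≈ 0# → ∀ k → Coprime k n → ¬ ¬ (X k ≈ 0#)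
  conjugate {X} a X1≈0 k cop Xk≉0 = basis (ζ ^_) n λ where
      (d , w , indep , coords) → Xk≉0 (vanishes (large-primes w indep coords a))
    where
    vanishes : (∃ λ A → ∀ p → A ℕ.< p → ∀ m z → ℤ[ ζ ] z → X m ≈ p · z → X m ≈ 0#) → X k ≈ 0#
    vanishes (A , large) with coprime⇒rough-representative (coprime-+ cop) A
    ... | t , rough = begin
      X k                            ≈⟨ Evaluations-periodic a k (suc t) ⟨
      X (k ℕ.+ n ℕ.* suc t)          ≡⟨ ≡.cong X m≡ ⟨
      X m                            ≡⟨ ≡.cong X (≡.trans (isFactorisation fact) (≡.sym (ℕₚ.*-identityˡ _))) ⟩
      X (1 ℕ.* product (factors fact)) ≈⟨ products (factors fact) large-factors 1 X1≈0 ⟩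
      0#                             ∎
      where
      open PrimeFactorisation
      -- The extra n keeps m positive, hence factorisable, even for k = 0, which is coprime to n
      -- when n = 1. The residue modulo n is unchanged.
      m = n ℕ.+ k ℕ.+ n ℕ.* t
      m≡ : m ≡ k ℕ.+ n ℕ.* suc t
      m≡ = ≡.trans (≡.cong (ℕ._+ n ℕ.* t) (ℕₚ.+-comm n k))
          (≡.trans (ℕₚ.+-assoc k n (n ℕ.* t)) (≡.cong (k ℕ.+_) (≡.sym (ℕₚ.*-suc n t))))
      instance
        m≢0 : NonZero m
        m≢0 = ℕ.>-nonZero (ℕₚ.≤-trans (ℕ.>-nonZero⁻¹ n) (ℕₚ.≤-trans (ℕₚ.m≤m+n n k) (ℕₚ.m≤m+n (n ℕ.+ k) (n ℕ.* t))))
      fact = factorise m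
      large-factors : All (λ q → Prime q × A ℕ.< q) (factors fact)
      large-factors = All.tabulate λ {q} q∈ → All.lookup (factorsPrime fact) q∈ ,
        ℕₚ.≰⇒> λ q≤A → rough q q≤A (All.lookup (factorsPrime fact) q∈)
          (≡.subst (q ℕᵈ.∣_) (≡.sym (isFactorisation fact)) (∈⇒∣product q∈))
      step : ∀ {q m} → Prime q → A ℕ.< q → X m ≈ 0# → X (m ℕ.* q) ≈ 0#
      step {q} {m} q-prime A<q Xm≈0 with frobenius q-prime a m
      ... | z , z∈ , e = large q A<q (m ℕ.* q) (- z) (minus z∈ refl) (begin
        X (m ℕ.* q)
          ≈⟨ solve 3 (λ x q z → x := (x :+ q :* z) :+ q :* :- z) refl _ (ι (fromℕ q)) z ⟩
        X (m ℕ.* q) + ι (fromℕ q) * z + ι (fromℕ q) * - z ≈⟨ +-cong (+-congˡ (sym (·≈ι* q z))) (sym (·≈ι* q (- z))) ⟩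
        X (m ℕ.* q) + q · z + q · - z
          ≈⟨ +-congʳ (trans (sym e) (≈0⇒^≈0 q {{prime⇒nonZero q-prime}} Xm≈0)) ⟩
        0# + q · - z                                     ≈⟨ +-identityˡ _ ⟩
        q · - z                                          ∎)
        where open Solver
      products : ∀ qs → All (λ q → Prime q × A ℕ.< q) qs → ∀ m → X m ≈ 0# → X (m ℕ.* product qs) ≈ 0#
      products [] [] m Xm≈0 = trans (reflexive (≡.cong X (ℕₚ.*-identityʳ m))) Xm≈0
      products (q ∷ qs) ((q-prime , A<q) ∷ all) m Xm≈0 =
        trans (reflexive (≡.cong X (≡.sym (ℕₚ.*-assoc m q (product qs)))))
            (products qs all (m ℕ.* q) (step q-prime A<q Xm≈0))

-- Gathers the vanishing of the n terms of Parseval's sum under a single double negation.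
¬¬-Fin : ∀ {a m} {P : Fin m → Set a} → (∀ i → ¬ ¬ P i) → ¬ ¬ (∀ i → P i)
¬¬-Fin {m = zero}  h k = k λ ()
¬¬-Fin {m = suc m} h k = h zero λ p₀ → ¬¬-Fin (h ∘ suc) λ ps → k λ { zero → p₀ ; (suc i) → ps i }

-- Orthogonality of characters

module Parseval {c ℓ} (K : ℚField c ℓ) (n : ℕ) .{{_ : NonZero n}} (ζ : ℚField.Carrier K)
  (ζ^n≈1 : Over.RootOfUnity K n ζ) (ζ^≉1 : Over.OrderAtLeast K n ζ) where
  open Over K
  open Conjugation K
  open Landau K n ζ ζ^n≈1

  eval : (Fin n → ℚ) → Carrier → Carrier
  eval f x = sum (λ j → ι (f j) * x ^ toℕ j)

  -- Landau's argument concerns integral polynomials, so f is multiplied by a common denominator D,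
  -- and the nonzero factor ι D is removed afterwards.
  eval-conjugate : ∀ f → eval f ζ ≈ 0# → ∀ k → Coprime k n → ¬ ¬ (eval f (ζ ^ k) ≈ 0#)
  eval-conjugate f f≈0 k cop fk≉0 = conjugate X-evaluations X1≈0 k cop λ Xk≈0 →
    fk≉0 (ι*≈0⇒≈0 D≢0 (trans (sym (X≈ k)) Xk≈0))
    where
    common = common-denominator n f
    D = fromℕ (proj₁ common)
    D≢0 = fromℕ≢0 (proj₁ common) {{proj₁ (proj₂ common)}}
    int = proj₂ (proj₂ common)
    X : ℕ → Carrier
    X k = sum (λ j → ι (fromℤ (proj₁ (int j))) * ζ ^ (k ℕ.* toℕ j))
    X-evaluations : Evaluations ζ X
    X-evaluations = Evaluations-sum _ λ j → Evaluations-scale (proj₁ (int j)) (power (toℕ j) λ _ → refl)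
    X≈ : ∀ k → X k ≈ ι D * eval f (ζ ^ k)
    X≈ k = trans (sum-cong-≋ (λ j → begin
        ι (fromℤ (proj₁ (int j))) * ζ ^ (k ℕ.* toℕ j)
          ≈⟨ *-cong (ι-cong (≡.sym (proj₂ (int j)))) (sym (^-assocʳ ζ k (toℕ j))) ⟩
        ι (D ℚ.* f j) * (ζ ^ k) ^ toℕ j                ≈⟨ trans (*-congʳ (ι-* D (f j))) (*-assoc _ _ _) ⟩
        ι D * (ι (f j) * (ζ ^ k) ^ toℕ j)              ∎))
      (sym (*-distribˡ-sum (ι D) (λ j → ι (f j) * (ζ ^ k) ^ toℕ j)))
    X1≈0 : X 1 ≈ 0#
    X1≈0 = trans (X≈ 1) (trans (*-congˡ
        (trans (sum-cong-≋ {n} (λ j → *-congˡ (^-congˡ (toℕ j) (*-identityʳ ζ)))) f≈0)) (zeroʳ _))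

  ζ^≉0 : ∀ k → ¬ (ζ ^ k ≈ 0#)
  ζ^≉0 k e = 1≉0 (begin
    1#               ≈⟨ ^-multiple k ⟨
    ζ ^ (n ℕ.* k)    ≡⟨ ≡.cong (ζ ^_) (ℕₚ.*-comm n k) ⟩
    ζ ^ (k ℕ.* n)    ≈⟨ ^-assocʳ ζ k n ⟨
    (ζ ^ k) ^ n      ≈⟨ ≈0⇒^≈0 n e ⟩
    0#               ∎)

  private
    distinct : ∀ {a b} → a ℕ.< b → b ℕ.< n → ¬ (ζ ^ a ≈ ζ ^ b)
    distinct {a} {b} a<b b<n e = ζ^≉1 (b ℕ.∸ a) (ℕₚ.m<n⇒0<n∸m a<b) (ℕₚ.≤-<-trans (ℕₚ.m∸n≤m b a) b<n)
      (*-cancelˡ (ζ^≉0 a) (begin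
        ζ ^ a * ζ ^ (b ℕ.∸ a)     ≈⟨ ^-homo-* ζ a (b ℕ.∸ a) ⟨
        ζ ^ (a ℕ.+ (b ℕ.∸ a))     ≡⟨ ≡.cong (ζ ^_) (ℕₚ.m+[n∸m]≡n (ℕₚ.<⇒≤ a<b)) ⟩
        ζ ^ b                     ≈⟨ e ⟨
        ζ ^ a                     ≈⟨ *-identityʳ _ ⟨
        ζ ^ a * 1#                ∎))

  ^-injective : ∀ (a b : Fin n) → ζ ^ toℕ a ≈ ζ ^ toℕ b → a ≡ b
  ^-injective a b e with ℕₚ.<-cmp (toℕ a) (toℕ b)
  ... | tri< a<b _ _ = contradiction e (distinct a<b (Finₚ.toℕ<n b))
  ... | tri≈ _ a≡b _ = Finₚ.toℕ-injective a≡b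
  ... | tri> _ _ b<a = contradiction (sym e) (distinct b<a (Finₚ.toℕ<n a))

  private
    -- Represents a - b modulo n, with n - 1 in place of -1.
    exponent : Fin n → Fin n → ℕ
    exponent a b = toℕ a ℕ.+ (n ℕ.∸ 1) ℕ.* toℕ b

    char : Fin n → Fin n → Carrier
    char a b = ζ ^ exponent a b

    char*ζ^b : ∀ a b → ζ ^ toℕ b * char a b ≈ ζ ^ toℕ a
    char*ζ^b a b = trans (sym (^-homo-* ζ (toℕ b) _)) (trans (reflexive (≡.cong (ζ ^_)
      (≡.trans (x∙yz≈y∙xz (toℕ b) (toℕ a) _) (≡.cong (λ m → toℕ a ℕ.+ m ℕ.* toℕ b) (ℕₚ.suc-pred n)))))
      (^-periodic (toℕ a) (toℕ b)))
      where
      open import Algebra.Properties.CommutativeSemigroup ℕₚ.+-commutativeSemigroup using (x∙yz≈y∙xz)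

    char-diagonal : ∀ a → char a a ≈ 1#
    char-diagonal a = *-cancelˡ (ζ^≉0 (toℕ a)) (trans (char*ζ^b a a) (sym (*-identityʳ _)))

    char-off-diagonal : ∀ {a b} → b ≢ a → ¬ (char a b ≈ 1#)
    char-off-diagonal {a} {b} b≢a e = b≢a (^-injective b a (begin
      ζ ^ toℕ b               ≈⟨ *-identityʳ _ ⟨
      ζ ^ toℕ b * 1#          ≈⟨ *-congˡ e ⟨
      ζ ^ toℕ b * char a b    ≈⟨ char*ζ^b a b ⟩
      ζ ^ toℕ a               ∎))

    char^n : ∀ a b → char a b ^ n ≈ 1#
    char^n a b = trans (^-assocʳ ζ (exponent a b) n)
      (trans (reflexive (≡.cong (ζ ^_) (ℕₚ.*-comm (exponent a b) n))) (^-multiple (exponent a b)))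

    char^ : ∀ a b k → (ζ ^ k) ^ toℕ a * (ζ ^ (k ℕ.* (n ℕ.∸ 1))) ^ toℕ b ≈ char a b ^ k
    char^ a b k = begin
      (ζ ^ k) ^ toℕ a * (ζ ^ (k ℕ.* (n ℕ.∸ 1))) ^ toℕ b
        ≈⟨ *-cong (^-assocʳ ζ k (toℕ a)) (^-assocʳ ζ (k ℕ.* (n ℕ.∸ 1)) (toℕ b)) ⟩
      ζ ^ (k ℕ.* toℕ a) * ζ ^ (k ℕ.* (n ℕ.∸ 1) ℕ.* toℕ b)     ≈⟨ ^-homo-* ζ (k ℕ.* toℕ a) _ ⟨
      ζ ^ (k ℕ.* toℕ a ℕ.+ k ℕ.* (n ℕ.∸ 1) ℕ.* toℕ b)
        ≡⟨ ≡.cong (ζ ^_) (≡.trans (≡.cong (k ℕ.* toℕ a ℕ.+_) (ℕₚ.*-assoc k _ (toℕ b)))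
            (≡.trans (≡.sym (ℕₚ.*-distribˡ-+ k (toℕ a) _)) (ℕₚ.*-comm k _))) ⟩
      ζ ^ (exponent a b ℕ.* k)                                ≈⟨ ^-assocʳ ζ (exponent a b) k ⟨
      char a b ^ k                                            ∎

  -- ζ^(n-1) stands for ζ⁻¹.
  parseval : ∀ f g → sum {n} (λ k → eval f (ζ ^ toℕ k) * eval g (ζ ^ (toℕ k ℕ.* (n ℕ.∸ 1))))
                     ≈ ι (fromℕ n) * ι (f ∙ g)
  parseval f g = begin
    sum {n} (λ k → eval f (ζ ^ toℕ k) * eval g (ζ ^ (toℕ k ℕ.* (n ℕ.∸ 1))))
      ≈⟨ sum-cong-≋ {n} (λ k → trans (*-distribʳ-sum {n} _ _) (sum-cong-≋ {n} (λ a → trans (*-distribˡ-sum {n} _ _)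
           (sum-cong-≋ {n} (λ b → trans (solve 4 (λ u x v y → u :* x :* (v :* y) := u :* v :* (x :* y)) refl _ _ _ _)
             (*-congˡ (char^ a b (toℕ k)))))))) ⟩
    sum {n} (λ k → sum {n} (λ a → sum {n} (λ b → ι (f a) * ι (g b) * char a b ^ toℕ k)))
      ≈⟨ ∑-comm {n} {n} _ ⟩
    sum {n} (λ a → sum {n} (λ k → sum {n} (λ b → ι (f a) * ι (g b) * char a b ^ toℕ k)))
      ≈⟨ sum-cong-≋ {n} (λ a → ∑-comm {n} {n} _) ⟩
    sum {n} (λ a → sum {n} (λ b → sum {n} (λ k → ι (f a) * ι (g b) * char a b ^ toℕ k)))
      ≈⟨ sum-cong-≋ {n} (λ a → sum-cong-≋ {n} (λ b → sym (*-distribˡ-sum {n} _ _))) ⟩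
    sum {n} (λ a → sum {n} (λ b → ι (f a) * ι (g b) * sum {n} (λ k → char a b ^ toℕ k)))
      ≈⟨ sum-cong-≋ {n} (λ a → sum-only {n} _ a (λ b b≢a →
           trans (*-congˡ (sum-of-powers≈0 n (char^n a b) (char-off-diagonal b≢a))) (zeroʳ _))) ⟩
    sum {n} (λ a → ι (f a) * ι (g a) * sum {n} (λ k → char a a ^ toℕ k))
      ≈⟨ sum-cong-≋ {n} (λ a → trans (*-cong (sym (ι-* (f a) (g a))) (diagonal a)) (*-comm _ _)) ⟩
    sum {n} (λ a → ι (fromℕ n) * ι (f a ℚ.* g a))
      ≈⟨ *-distribˡ-sum {n} _ _ ⟨
    ι (fromℕ n) * sum {n} (λ a → ι (f a ℚ.* g a))
      ≈⟨ *-congˡ (ι-sum (λ a → f a ℚ.* g a)) ⟨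
    ι (fromℕ n) * ι (f ∙ g) ∎
    where
    open Solver
    diagonal : ∀ a → sum {n} (λ k → char a a ^ toℕ k) ≈ ι (fromℕ n)
    diagonal a = begin
      sum {n} (λ k → char a a ^ toℕ k)
        ≈⟨ sum-cong-≋ {n} (λ k → trans (^-congˡ (toℕ k) (char-diagonal a)) (1^ (toℕ k))) ⟩
      sum {n} (λ k → 1#)                ≈⟨ sum-replicate n ⟩
      n · 1#                            ≈⟨ ·≈ι* n 1# ⟩
      ι (fromℕ n) * 1#                  ≈⟨ *-identityʳ _ ⟩
      ι (fromℕ n)                       ∎

  -- Every term of Parseval's sum has a vanishing factor: f at the conjugates of ζ, g elsewhere. The
  -- former holds only up to double negation, which suffices because equality with `0ℚ` is decided
  -- first.
  orthogonal : ∀ f g → eval f ζ ≈ 0# →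
    (∀ k → Coprime k n ⊎ eval g (ζ ^ (k ℕ.* (n ℕ.∸ 1))) ≈ 0#) → f ∙ g ≡ 0ℚ
  orthogonal f g f≈0 h with f ∙ g ℚ.≟ 0ℚ
  ... | yes fg≡0 = fg≡0
  ... | no fg≢0 = contradiction (λ products≈0 → fg≢0 (ι≈0⇒≡0 _ (ι*≈0⇒≈0 (fromℕ≢0 n)
          (trans (sym (parseval f g)) (sum≈0 {n} products≈0))))) (¬¬-Fin product≈0)
    where
    product≈0 : ∀ (k : Fin n) → ¬ ¬ (eval f (ζ ^ toℕ k) * eval g (ζ ^ (toℕ k ℕ.* (n ℕ.∸ 1))) ≈ 0#)
    product≈0 k ≉0 with h (toℕ k)
    ... | inj₁ cop  = eval-conjugate f f≈0 (toℕ k) cop λ e → ≉0 (trans (*-congʳ e) (zeroˡ _))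
    ... | inj₂ g≈0 = ≉0 (trans (*-congˡ g≈0) (zeroʳ _))

-- Relations and cycles on the join

sumℚ-++ : ∀ xs ys → sumℚ (xs ++ ys) ≡ sumℚ xs ℚ.+ sumℚ ys
sumℚ-++ []       ys = ≡.sym (ℚₚ.+-identityˡ _)
sumℚ-++ (x ∷ xs) ys = ≡.trans (≡.cong (x ℚ.+_) (sumℚ-++ xs ys)) (≡.sym (ℚₚ.+-assoc x _ _))

sumℚ-allFacets : ∀ {r} (ps : Vec ℕ r) h → sumℚ (map h (allFacets ps)) ≡ ℚF.sumFacet ps h
sumℚ-allFacets []       h = ℚₚ.+-identityʳ _
sumℚ-allFacets (p ∷ ps) h = go p (λ a → a)
  where
  go : ∀ m (g : Fin m → Fin p) →
    sumℚ (map h (concatMap (λ a → map (a ,_) (allFacets ps)) (tabulate g)))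
    ≡ ℚΣ.sum (λ i → ℚF.sumFacet ps (λ f → h (g i , f)))
  go zero    g = ≡.refl
  go (suc m) g = begin
    sumℚ (map h (block ++ rest))                   ≡⟨ ≡.cong sumℚ (Listₚ.map-++ h block rest) ⟩
    sumℚ (map h block ++ map h rest)     ≡⟨ sumℚ-++ (map h block) _ ⟩
    sumℚ (map h block) ℚ.+ sumℚ (map h rest)
      ≡⟨ ≡.cong₂ ℚ._+_ (≡.trans (≡.cong sumℚ (≡.sym (Listₚ.map-∘ (allFacets ps)))) (sumℚ-allFacets ps _))
          (go m (g ∘ suc)) ⟩
    ℚΣ.sum (λ i → ℚF.sumFacet ps (λ f → h (g i , f)))                  ∎
    where
    open ≡.≡-Reasoning
    block = map (g zero ,_) (allFacets ps)
    rest = concatMap (λ a → map (a ,_) (allFacets ps)) (tabulate (g ∘ suc))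

∈-allFacets : ∀ {r} (ps : Vec ℕ r) f → f ∈ allFacets ps
∈-allFacets []       tt      = here ≡.refl
∈-allFacets (p ∷ ps) (a , f) = ∈-concatMap⁺ _ (lose (∈-allFin a) (∈-map⁺ (a ,_) (∈-allFacets ps f)))

sign≢0 : ∀ i → sign i ≢ 0ℚ
sign≢0 zero    ()
sign≢0 (suc i) e = sign≢0 i (≡.trans (≡.sym (⁻¹-involutive (sign i))) (≡.cong ℚ.-_ e))
  where open import Algebra.Properties.Group ℚₚ.+-0-group using (⁻¹-involutive)

∂≡sign*indicator : ∀ {r} (ps : Vec ℕ r) f i w →
  ∂ {ps = ps} f (i , w) ≡ sign (toℕ i) ℚ.* ℚF.indicator (agreeOff {ps = ps} f w i)
∂≡sign*indicator ps f i w with agreeOff {ps = ps} f w i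
... | true  = ≡.sym (ℚₚ.*-identityʳ _)
... | false = ≡.sym (ℚₚ.*-zeroʳ (sign (toℕ i)))

-- All facets through a ridge are completed by a vertex of the same part i, so they enter with one
-- common sign, which can be divided out.
boundary≡0⇒agreeOff-sum≡0 : ∀ {r} (ps : Vec ℕ r) c i w →
  sumℚ (map (λ f → c f ℚ.* ∂ {ps = ps} f (i , w)) (allFacets ps)) ≡ 0ℚ → ℚF.agreeOff-sum ps c w i ≡ 0ℚ
boundary≡0⇒agreeOff-sum≡0 ps c i w e = *≡0⇒≡0 (sign≢0 (toℕ i)) (≡.trans (≡.sym (≡.trans (sumℚ-allFacets ps _)
  (≡.trans (ℚF.sumFacet-cong ps (λ f → ≡.trans (≡.cong (c f ℚ.*_) (∂≡sign*indicator ps f i w))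
    (solve 3 (λ c s t → c :* (s :* t) := s :* (c :* t)) ≡.refl (c f) (sign (toℕ i)) _)))
    (ℚF.sumFacet-*ˡ ps (sign (toℕ i)) _)))) e)
  where open Data.Rational.Solver.+-*-Solver

cycle-slice : ∀ {r} p (ps : Vec ℕ r) (c : Facet (p ∷ ps) → ℚ) → (∀ w → ℚF.agreeOff-sum (p ∷ ps) c w zero ≡ 0ℚ) →
  ∀ f → ℚΣ.sum (λ a → c (a , f)) ≡ 0ℚ
-- A ridge omitting part 0 is written with an arbitrary vertex there, so `zero` serves as filler; if
-- the part has no vertex, the sum is empty.
cycle-slice zero    ps c cycle f = ≡.refl
cycle-slice (suc p) ps c cycle f = ≡.trans (≡.sym (ℚF.agreeOff-sum-zero ps c (zero , f))) (cycle (zero , f))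

module Join {c ℓ} (K : ℚField c ℓ) where
  open Over K

  -- With yᵢ = 1 the monomial does not depend on the i-th vertex. Summing over that vertex first
  -- produces the ridge sums of c, which are zero.
  cycle-evaluation≈0 : ∀ {r} (ps : Vec ℕ r) (c : Facet ps → ℚ) i → (∀ w → ℚF.agreeOff-sum ps c w i ≡ 0ℚ) →
    ∀ ys → lookup ys i ≈ 1# → sumFacet ps (λ f → ι (c f) * monomial ys f) ≈ 0#
  cycle-evaluation≈0 (p ∷ ps) c zero cycle (y ∷ ys) y≈1 = trans (sum-sumFacet {n = p} ps _)
      (sumFacet-zero ps λ f → begin
    sum (λ a → ι (c (a , f)) * (y ^ toℕ a * monomial ys f))
      ≈⟨ sum-cong-≋ {p} (λ a → *-congˡ (trans (*-congʳ (trans (^-congˡ (toℕ a) y≈1) (1^ (toℕ a)))) (*-identityˡ _))) ⟩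
    sum (λ a → ι (c (a , f)) * monomial ys f)     ≈⟨ *-distribʳ-sum {p} (monomial ys f) (λ a → ι (c (a , f))) ⟨
    sum (λ a → ι (c (a , f))) * monomial ys f
      ≈⟨ *-congʳ (trans (sym (ι-sum {p} (λ a → c (a , f)))) (ι-cong (cycle-slice p ps c cycle f))) ⟩
    ι 0ℚ * monomial ys f                          ≈⟨ trans (*-congʳ ι-0) (zeroˡ _) ⟩
    0#                                            ∎)
  cycle-evaluation≈0 (p ∷ ps) c (suc i) cycle (y ∷ ys) yᵢ≈1 = sum≈0 {p} λ a → begin
    sumFacet ps (λ f → ι (c (a , f)) * (y ^ toℕ a * monomial ys f))
      ≈⟨ sumFacet-cong ps (λ f → solve 3 (λ c y m → c :* (y :* m) := y :* (c :* m)) refl _ _ _) ⟩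
    sumFacet ps (λ f → y ^ toℕ a * (ι (c (a , f)) * monomial ys f))
      ≈⟨ sumFacet-*ˡ ps (y ^ toℕ a) _ ⟩
    y ^ toℕ a * sumFacet ps (λ f → ι (c (a , f)) * monomial ys f)
      ≈⟨ *-congˡ (cycle-evaluation≈0 ps (λ f → c (a , f)) i
          (λ w → ≡.trans (≡.sym (ℚF.agreeOff-sum-suc ps c (a , w) i)) (cycle (a , w))) ys yᵢ≈1) ⟩
    y ^ toℕ a * 0#    ≈⟨ zeroʳ _ ⟩
    0#                ∎
    where open Solver

  -- The facets through the ridge contribute a fixed monomial times the geometric sum of the powers
  -- of yᵢ, a nontrivial pᵢ-th root of unity.
  ridge-evaluation≈0 : ∀ {r} (ps : Vec ℕ r) ys i → lookup ys i ^ lookup ps i ≈ 1# → ¬ (lookup ys i ≈ 1#) →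
    ∀ w → agreeOff-sum ps (monomial ys) w i ≈ 0#
  ridge-evaluation≈0 (p ∷ ps) (y ∷ ys) zero y^p≈1 y≉1 (b , w) = trans (agreeOff-sum-zero ps (monomial (y ∷ ys)) (b , w))
    (trans (sym (*-distribʳ-sum {p} (monomial ys w) (λ a → y ^ toℕ a)))
    (trans (*-congʳ (sum-of-powers≈0 p y^p≈1 y≉1)) (zeroˡ _)))
  ridge-evaluation≈0 (p ∷ ps) (y ∷ ys) (suc i) yᵢ^pᵢ≈1 yᵢ≉1 (b , w) = trans
      (agreeOff-sum-suc ps (monomial (y ∷ ys)) (b , w) i)
    (trans (sumFacet-cong ps (λ f → *-assoc _ _ _))
    (trans (sumFacet-*ˡ ps (y ^ toℕ b) _)
    (trans (*-congˡ (ridge-evaluation≈0 ps ys i yᵢ^pᵢ≈1 yᵢ≉1 w)) (zeroʳ _))))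

  boundary-evaluation≈0 : ∀ {r} (ps : Vec ℕ r) ys i → lookup ys i ^ lookup ps i ≈ 1# → ¬ (lookup ys i ≈ 1#) →
    ∀ w → sumFacet ps (λ f → ι (∂ {ps = ps} f (i , w)) * monomial ys f) ≈ 0#
  boundary-evaluation≈0 ps ys i y^p≈1 y≉1 w = begin
    sumFacet ps (λ f → ι (∂ {ps = ps} f (i , w)) * monomial ys f)
      ≈⟨ sumFacet-cong ps (λ f → begin
           ι (∂ {ps = ps} f (i , w)) * monomial ys f
             ≈⟨ *-congʳ (trans (ι-cong (∂≡sign*indicator ps f i w)) (ι-* _ _)) ⟩
           ι (sign (toℕ i)) * ι (ℚF.indicator (agreeOff {ps = ps} f w i)) * monomial ys f
             ≈⟨ *-congʳ (*-congˡ (ι-indicator (agreeOff {ps = ps} f w i))) ⟩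
           ι (sign (toℕ i)) * indicator (agreeOff {ps = ps} f w i) * monomial ys f
             ≈⟨ solve 3 (λ s t m → s :* t :* m := s :* (m :* t)) refl _ _ _ ⟩
           ι (sign (toℕ i)) * (monomial ys f * indicator (agreeOff {ps = ps} f w i)) ∎) ⟩
    sumFacet ps (λ f → ι (sign (toℕ i)) * (monomial ys f * indicator (agreeOff {ps = ps} f w i)))
      ≈⟨ sumFacet-*ˡ ps (ι (sign (toℕ i))) _ ⟩
    ι (sign (toℕ i)) * agreeOff-sum ps (monomial ys) w i
      ≈⟨ trans (*-congˡ (ridge-evaluation≈0 ps ys i y^p≈1 y≉1 w)) (zeroʳ _) ⟩
    0# ∎
    where
    open Solver
    ι-indicator : ∀ b → ι (ℚF.indicator b) ≈ indicator b
    ι-indicator true  = ι-1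
    ι-indicator false = ι-0

  -- The i-th entry is x ^ (prodℕ ps / pᵢ).
  bases : ∀ {r} → Carrier → Vec ℕ r → Vec Carrier r
  bases x []       = []
  bases x (p ∷ ps) = x ^ prodℕ ps ∷ bases (x ^ p) ps

  ^-expo : ∀ {r} x (ps : Vec ℕ r) f → x ^ expo ps f ≈ monomial (bases x ps) f
  ^-expo x []       tt      = refl
  ^-expo x (p ∷ ps) (a , f) = begin
    x ^ (toℕ a ℕ.* prodℕ ps ℕ.+ p ℕ.* expo ps f)       ≈⟨ ^-homo-* x (toℕ a ℕ.* prodℕ ps) (p ℕ.* expo ps f) ⟩
    x ^ (toℕ a ℕ.* prodℕ ps) * x ^ (p ℕ.* expo ps f)
      ≈⟨ *-cong (reflexive (≡.cong (x ^_) (ℕₚ.*-comm (toℕ a) (prodℕ ps)))) (sym (^-assocʳ x p (expo ps f))) ⟩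
    x ^ (prodℕ ps ℕ.* toℕ a) * (x ^ p) ^ expo ps f
      ≈⟨ *-cong (sym (^-assocʳ x (prodℕ ps) (toℕ a))) (^-expo (x ^ p) ps f) ⟩
    (x ^ prodℕ ps) ^ toℕ a * monomial (bases (x ^ p) ps) f ∎

  bases^p≈1 : ∀ {r} x (ps : Vec ℕ r) → x ^ prodℕ ps ≈ 1# → ∀ i → lookup (bases x ps) i ^ lookup ps i ≈ 1#
  bases^p≈1 x (p ∷ ps) x^P≈1 zero = trans (^-assocʳ x (prodℕ ps) p)
    (trans (reflexive (≡.cong (x ^_) (ℕₚ.*-comm (prodℕ ps) p))) x^P≈1)
  bases^p≈1 x (p ∷ ps) x^P≈1 (suc i) = bases^p≈1 (x ^ p) ps (trans (^-assocʳ x p (prodℕ ps)) x^P≈1) i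

  -- P/pᵢ is a positive exponent below P because pᵢ exceeds 1. In the recursion, x^p inherits order
  -- at least P/p.
  bases≉1 : ∀ {r} x (ps : Vec ℕ r) → (∀ i → Prime (lookup ps i)) →
    OrderAtLeast (prodℕ ps) x → ∀ i → ¬ (lookup (bases x ps) i ≈ 1#)
  bases≉1 x (p ∷ ps) primes order zero = order (prodℕ ps) (ℕ.>-nonZero⁻¹ P)
    (≡.subst (ℕ._< p ℕ.* P) (ℕₚ.*-identityˡ P) (ℕₚ.*-monoˡ-< P (ℕ.nonTrivial⇒n>1 p)))
    where
    P = prodℕ ps
    instance
      _ = prodℕ≢0 ps (primes ∘ suc)
      _ = prime⇒nonTrivial (primes zero)
  bases≉1 x (p ∷ ps) primes order (suc i) = bases≉1 (x ^ p) ps (primes ∘ suc) (λ k 0<k k<P e →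
    order (p ℕ.* k) (≡.subst (ℕ._< p ℕ.* k) (ℕₚ.*-zeroʳ p) (ℕₚ.*-monoʳ-< p 0<k)) (ℕₚ.*-monoʳ-< p k<P)
      (trans (sym (^-assocʳ x p k)) e)) i
    where
    instance _ = prime⇒nonZero (primes zero)

  -- The entry is y raised to k P/pᵢ, a multiple of P. The auxiliary y lets the recursion raise x
  -- and y to the power p together while k stays fixed.
  bases≈1 : ∀ {r} {x y} (ps : Vec ℕ r) k i → lookup ps i ℕᵈ.∣ k → y ^ prodℕ ps ≈ 1# → x ≈ y ^ k →
    lookup (bases x ps) i ≈ 1#
  bases≈1 {x = x} {y} (p ∷ ps) k zero (ℕᵈ.divides q k≡qp) y^P≈1 x≈y^k = begin
    x ^ prodℕ ps                  ≈⟨ ^-congˡ (prodℕ ps) x≈y^k ⟩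
    (y ^ k) ^ prodℕ ps            ≈⟨ ^-assocʳ y k (prodℕ ps) ⟩
    y ^ (k ℕ.* prodℕ ps)
      ≡⟨ ≡.cong (y ^_) (≡.trans (≡.cong (ℕ._* prodℕ ps) k≡qp) (≡.trans (ℕₚ.*-assoc q p (prodℕ ps)) (ℕₚ.*-comm q _))) ⟩
    y ^ (p ℕ.* prodℕ ps ℕ.* q)    ≈⟨ ^-assocʳ y (p ℕ.* prodℕ ps) q ⟨
    (y ^ (p ℕ.* prodℕ ps)) ^ q    ≈⟨ trans (^-congˡ q y^P≈1) (1^ q) ⟩
    1#                            ∎
  bases≈1 {x = x} {y} (p ∷ ps) k (suc i) pᵢ∣k y^P≈1 x≈y^k = bases≈1 {y = y ^ p} ps k i pᵢ∣k
    (trans (^-assocʳ y p (prodℕ ps)) y^P≈1) (begin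
      x ^ p            ≈⟨ ^-congˡ p x≈y^k ⟩
      (y ^ k) ^ p      ≈⟨ ^-assocʳ y k p ⟩
      y ^ (k ℕ.* p)    ≡⟨ ≡.cong (y ^_) (ℕₚ.*-comm k p) ⟩
      y ^ (p ℕ.* k)    ≈⟨ ^-assocʳ y p k ⟨
      (y ^ p) ^ k      ∎)

-- Transport of bases along a bijection, and common prime factors

basis-transport : ∀ {a b ℓ ℓ′} {E : Set a} {E′ : Set b} {Ind : (E → Bool) → Set ℓ} {Ind′ : (E′ → Bool) → Set ℓ′}
  (σ : E ↔ E′) →
  (∀ {S S′} → (∀ x → S (Inverse.from σ x) ≡ S′ x) → Ind S → Ind′ S′) →
  (∀ {S S′} → (∀ e → S e ≡ S′ (Inverse.to σ e)) → Ind′ S′ → Ind S) →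
  ∀ {B} → IsBasis Ind B → IsBasis Ind′ (B ∘ Inverse.from σ)
basis-transport σ fwd bwd {B} (ind , maximal) = fwd (λ _ → ≡.refl) ind , λ S′ indS′ B⊆S′ x S′x →
  maximal (S′ ∘ to) (bwd (λ _ → ≡.refl) indS′)
    (λ e Be → B⊆S′ (to e) (≡.trans (≡.cong B (strictlyInverseʳ e)) Be))
    (from x) (≡.trans (≡.cong S′ (strictlyInverseˡ x)) S′x)
  where open Inverse σ

basis-transport⁻ : ∀ {a b ℓ ℓ′} {E : Set a} {E′ : Set b} {Ind : (E → Bool) → Set ℓ} {Ind′ : (E′ → Bool) → Set ℓ′}
  (σ : E ↔ E′) →
  (∀ {S S′} → (∀ x → S (Inverse.from σ x) ≡ S′ x) → Ind S → Ind′ S′) →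
  (∀ {S S′} → (∀ e → S e ≡ S′ (Inverse.to σ e)) → Ind′ S′ → Ind S) →
  ∀ {B} → IsBasis Ind′ (B ∘ Inverse.from σ) → IsBasis Ind B
basis-transport⁻ σ fwd bwd {B} (ind , maximal) = bwd (λ e → ≡.sym (≡.cong B (strictlyInverseʳ e))) ind ,
    λ S indS B⊆S e Se →
  ≡.trans (≡.sym (≡.cong B (strictlyInverseʳ e)))
    (maximal (S ∘ from) (fwd (λ _ → ≡.refl) indS) (λ x Bx → B⊆S (from x) Bx) (to e)
        (≡.trans (≡.cong S (strictlyInverseʳ e)) Se))
  where open Inverse σ

common-prime : ∀ {k n} .{{_ : NonZero n}} → ¬ Coprime k n → ∃ λ q → Prime q × q ℕᵈ.∣ k × q ℕᵈ.∣ n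
common-prime {k} {n} ¬coprime = go (factors fact) (isFactorisation fact) (factorsPrime fact)
  where
  open PrimeFactorisation
  d = gcd k n
  instance
    d≢0 : NonZero d
    d≢0 = ℕ.≢-nonZero λ d≡0 → ℕ.≢-nonZero⁻¹ n (ℕᵈ.0∣⇒≡0 (≡.subst (ℕᵈ._∣ n) d≡0 (gcd[m,n]∣n k n)))
  fact = factorise d
  go : ∀ qs → d ≡ product qs → All Prime qs → ∃ λ q → Prime q × q ℕᵈ.∣ k × q ℕᵈ.∣ n
  go []       d≡1 _             = ⊥-elim (¬coprime (gcd≡1⇒coprime d≡1))
  go (q ∷ qs) d≡  (q-prime ∷ _) = q , q-prime , ℕᵈ.∣-trans q∣d (gcd[m,n]∣m k n) , ℕᵈ.∣-trans q∣d (gcd[m,n]∣n k n)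
    where
    q∣d : q ℕᵈ.∣ d
    q∣d = ℕᵈ.divides (product qs) (≡.trans d≡ (ℕₚ.*-comm q (product qs)))

-- Relations among the powers of ζ against cycles on the copies

module _ {c ℓ} (K : ℚField c ℓ) where
  open Over K

  sumFin≈sum : ∀ m (f : Fin m → Carrier) → sumFin K m f ≈ sum f
  sumFin≈sum zero    f = refl
  sumFin≈sum (suc m) f = +-congˡ (sumFin≈sum m (f ∘ suc))

  pow≈^ : ∀ x m → pow K x m ≈ x ^ m
  pow≈^ x zero    = refl
  pow≈^ x (suc m) = *-congˡ (pow≈^ x m)

-- The exponents mᵢ are summarised by N and by the condition that every prime divisor of n occurs in
-- `ps`.
module Main {c ℓ} (K : ℚField c ℓ) {r} (ps : Vec ℕ r)
  (primes : ∀ i → Prime (lookup ps i)) (distinct : ∀ i j → lookup ps i ≡ lookup ps j → i ≡ j)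
  (N : ℕ) (prime-divisors : ∀ {q} → Prime q → q ℕᵈ.∣ N ℕ.* prodℕ ps → ∃ λ i → q ≡ lookup ps i)
  .{{n≢0 : NonZero (N ℕ.* prodℕ ps)}}
  (ζ : ℚField.Carrier K) (ζ^n≈1 : Over.RootOfUnity K (N ℕ.* prodℕ ps) ζ)
  (ζ^≉1 : Over.OrderAtLeast K (N ℕ.* prodℕ ps) ζ) where
  open Over K
  open Join K
  private
    P = prodℕ ps
    n = N ℕ.* P

  open Parseval K n ζ ζ^n≈1 ζ^≉1
  open Encoding N ps primes distinct
  open Inverse encode↔ using (to; from; strictlyInverseˡ; strictlyInverseʳ)

  to-encode : ∀ x → to (encode x) ≡ x
  to-encode x = ≡.trans (≡.cong to (≡.sym (encode↔-from x))) (strictlyInverseˡ x)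

  -- Since y^n = 1, the reduction modulo n in `encode` is invisible, and the value splits into N
  -- evaluations on copies of the facets, weighted by y^j.
  eval-encode : ∀ f y → y ^ n ≈ 1# →
    eval f y ≈ sum (λ j → y ^ toℕ j * sumFacet ps (λ w → ι (f (encode (j , w))) * monomial (bases (y ^ N) ps) w))
  eval-encode f y y^n≈1 = trans (sum-encode N ps primes distinct (λ k → ι (f k) * y ^ toℕ k))
    (sum-cong-≋ {N} λ j → trans (sumFacet-cong ps (λ w → begin
      ι (f (encode (j , w))) * y ^ toℕ (encode (j , w))
        ≈⟨ *-congˡ (trans (reflexive (≡.cong (y ^_) (toℕ-encode (j , w))))
            (sym (Landau.^-% K n y y^n≈1 (exponent (j , w))))) ⟩
      ι (f (encode (j , w))) * y ^ (toℕ j ℕ.+ N ℕ.* expo ps w)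
        ≈⟨ *-congˡ (trans (^-homo-* y (toℕ j) (N ℕ.* expo ps w))
            (*-congˡ (trans (sym (^-assocʳ y N (expo ps w))) (^-expo (y ^ N) ps w)))) ⟩
      ι (f (encode (j , w))) * (y ^ toℕ j * monomial (bases (y ^ N) ps) w)
        ≈⟨ x∙yz≈y∙xz (ι (f (encode (j , w)))) (y ^ toℕ j) (monomial (bases (y ^ N) ps) w) ⟩
      y ^ toℕ j * (ι (f (encode (j , w))) * monomial (bases (y ^ N) ps) w) ∎))
      (sumFacet-*ˡ ps (y ^ toℕ j) (λ w → ι (f (encode (j , w))) * monomial (bases (y ^ N) ps) w)))
    where open import Algebra.Properties.CommutativeSemigroup *-commutativeSemigroup using (x∙yz≈y∙xz)

  -- A row of the block-diagonal boundary matrix, with its columns renamed from facets to exponents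
  -- of ζ.
  row : Fin N × Ridge ps → Fin n → ℚ
  row (j , ρ) k = if does (proj₁ (to k) Fin.≟ j) then ∂ {ps = ps} (proj₂ (to k)) ρ else 0ℚ

  row-encode : ∀ j ρ j′ w → row (j , ρ) (encode (j′ , w)) ≡ (if does (j′ Fin.≟ j) then ∂ {ps = ps} w ρ else 0ℚ)
  row-encode j ρ j′ w rewrite to-encode (j′ , w) = ≡.refl

  row-encode-same : ∀ j ρ w → row (j , ρ) (encode (j , w)) ≡ ∂ {ps = ps} w ρ
  row-encode-same j ρ w with j Fin.≟ j | row-encode j ρ j w
  ... | yes _  | e = e
  ... | no j≢j | _ = contradiction ≡.refl j≢j

  row-encode-other : ∀ {j j′} ρ w → j′ ≢ j → row (j , ρ) (encode (j′ , w)) ≡ 0ℚ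
  row-encode-other {j} {j′} ρ w j′≢j with j′ Fin.≟ j | row-encode j ρ j′ w
  ... | yes j′≡j | _ = contradiction j′≡j j′≢j
  ... | no _     | e = e

  ridge-indices : List (Fin N × Ridge ps)
  ridge-indices = cartesianProduct (allFin N) (cartesianProduct (allFin r) (allFacets ps))

  rows : List (Fin n → ℚ)
  rows = map row ridge-indices

  ∈-ridge-indices : ∀ x → x ∈ ridge-indices
  ∈-ridge-indices (j , i , w) = ∈-cartesianProduct⁺ (∈-allFin j) (∈-cartesianProduct⁺ (∈-allFin i) (∈-allFacets ps w))

  block-boundary : (Fin n → ℚ) → Fin N → Ridge ps → ℚ
  block-boundary z j ρ = sumℚ (map (λ w → z (encode (j , w)) ℚ.* ∂ {ps = ps} w ρ) (allFacets ps))

  ∙-row : ∀ z j ρ → z ∙ row (j , ρ) ≡ block-boundary z j ρ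
  ∙-row z j ρ = ≡.trans (ℚF.sum-encode N ps primes distinct (λ k → z k ℚ.* row (j , ρ) k))
    (≡.trans (ℚF.sum-only (λ j′ → ℚF.sumFacet ps (λ w → z (encode (j′ , w)) ℚ.* row (j , ρ) (encode (j′ , w)))) j
      (λ j′ j′≢j → ℚF.sumFacet-zero ps λ w → ≡.trans (≡.cong (z (encode (j′ , w)) ℚ.*_) (row-encode-other ρ w j′≢j))
          (ℚₚ.*-zeroʳ (z (encode (j′ , w))))))
    (≡.trans (ℚF.sumFacet-cong ps (λ w → ≡.cong (z (encode (j , w)) ℚ.*_) (row-encode-same j ρ w)))
      (≡.sym (sumℚ-allFacets ps (λ w → z (encode (j , w)) ℚ.* ∂ {ps = ps} w ρ)))))

  Relation : (Fin n → ℚ) → Set ℓ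
  Relation f = eval f ζ ≈ 0#

  Cycle : (Fin n → ℚ) → Set
  Cycle z = Kills z rows

  cycle-boundary : ∀ {z} → Cycle z → ∀ j ρ → block-boundary z j ρ ≡ 0ℚ
  cycle-boundary {z} cycle j ρ = ≡.trans (≡.sym (∙-row z j ρ)) (All.lookup cycle (∈-map⁺ row (∈-ridge-indices (j , ρ))))

  boundary-cycle : ∀ {z} → (∀ j ρ → block-boundary z j ρ ≡ 0ℚ) → Cycle z
  boundary-cycle {z} ∂z≡0 = Allₚ.map⁺ (All.universal (λ (j , ρ) → ≡.trans (∙-row z j ρ) (∂z≡0 j ρ)) ridge-indices)

  -- Only block j contributes. There ζ^N has order P, so its power with exponent P/pᵢ is a
  -- nontrivial pᵢ-th root of unity and the geometric sum along the ridge vanishes.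
  row-relation : ∀ x → Relation (row x)
  row-relation (j , i , v) = trans (eval-encode (row (j , i , v)) ζ ζ^n≈1) (sum≈0 {N} λ j′ →
    trans (*-congˡ (block j′)) (zeroʳ _))
    where
    ys = bases (ζ ^ N) ps
    block : ∀ j′ → sumFacet ps (λ w → ι (row (j , i , v) (encode (j′ , w))) * monomial ys w) ≈ 0#
    block j′ with j′ Fin.≟ j
    ... | no j′≢j = sumFacet-zero ps λ w → trans (*-congʳ (trans (ι-cong (row-encode-other (i , v) w j′≢j)) ι-0))
        (zeroˡ _)
    ... | yes ≡.refl = trans (sumFacet-cong ps (λ w → *-congʳ (ι-cong (row-encode-same j (i , v) w))))
          (boundary-evaluation≈0 ps ys i (bases^p≈1 (ζ ^ N) ps (trans (^-assocʳ ζ N P) ζ^n≈1) i)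
            (bases≉1 (ζ ^ N) ps primes order i) v)
      where
      instance
        N≢0 : NonZero N
        N≢0 = ℕₚ.m*n≢0⇒m≢0 N {P}
      order : OrderAtLeast P (ζ ^ N)
      order k 0<k k<P e = ζ^≉1 (N ℕ.* k) (≡.subst (ℕ._< N ℕ.* k) (ℕₚ.*-zeroʳ N) (ℕₚ.*-monoʳ-< N 0<k))
        (ℕₚ.*-monoʳ-< N k<P) (trans (sym (^-assocʳ ζ N k)) e)

  cycle-vanishes : ∀ {z} → Cycle z → ∀ k i → lookup ps i ℕᵈ.∣ k → eval z (ζ ^ (k ℕ.* (n ℕ.∸ 1))) ≈ 0#
  cycle-vanishes {z} cycle k i pᵢ∣k = trans (eval-encode z η η^n≈1)
    (sum≈0 {N} λ j → trans (*-congˡ (cycle-evaluation≈0 ps (λ w → z (encode (j , w))) i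
      (λ w → boundary≡0⇒agreeOff-sum≡0 ps (λ w → z (encode (j , w))) i w (cycle-boundary {z} cycle j (i , w)))
      (bases (η ^ N) ps) (bases≈1 {y = y} ps k i pᵢ∣k y^P≈1 η^N≈y^k))) (zeroʳ _))
    where
    ζ^n* = Landau.^-multiple K n ζ ζ^n≈1
    -- η is ζ^(-k), the point that Parseval pairs with ζ^k, and y is ζ^(-N), a P-th root of unity
    -- with η^N = y^k. Hence pᵢ dividing k makes the i-th base of η^N trivial.
    η = ζ ^ (k ℕ.* (n ℕ.∸ 1))
    y = ζ ^ ((n ℕ.∸ 1) ℕ.* N)
    η^n≈1 : η ^ n ≈ 1#
    η^n≈1 = trans (^-assocʳ ζ (k ℕ.* (n ℕ.∸ 1)) n)
      (trans (reflexive (≡.cong (ζ ^_) (ℕₚ.*-comm (k ℕ.* (n ℕ.∸ 1)) n))) (ζ^n* (k ℕ.* (n ℕ.∸ 1))))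
    y^P≈1 : y ^ P ≈ 1#
    y^P≈1 = trans (^-assocʳ ζ ((n ℕ.∸ 1) ℕ.* N) P) (trans (reflexive (≡.cong (ζ ^_)
      (≡.trans (ℕₚ.*-assoc (n ℕ.∸ 1) N P) (ℕₚ.*-comm (n ℕ.∸ 1) n)))) (ζ^n* (n ℕ.∸ 1)))
    η^N≈y^k : η ^ N ≈ y ^ k
    η^N≈y^k = trans (^-assocʳ ζ (k ℕ.* (n ℕ.∸ 1)) N) (trans (reflexive (≡.cong (ζ ^_)
      (≡.trans (ℕₚ.*-assoc k (n ℕ.∸ 1) N) (ℕₚ.*-comm k _)))) (sym (^-assocʳ ζ ((n ℕ.∸ 1) ℕ.* N) k)))

  relation⊥cycle : Orthogonal Relation Cycle
  relation⊥cycle f z f≈0 cycle = orthogonal f z f≈0 λ k → case k (coprime? k n)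
    where
    case : ∀ k → Dec (Coprime k n) → Coprime k n ⊎ eval z (ζ ^ (k ℕ.* (n ℕ.∸ 1))) ≈ 0#
    case k (yes cop) = inj₁ cop
    case k (no ¬cop) with common-prime {k} {n} ¬cop
    ... | q , q-prime , q∣k , q∣n with prime-divisors q-prime q∣n
    ...   | i , ≡.refl = inj₂ (cycle-vanishes {z} cycle k i q∣k)

  relation-alternative : Alternative Relation Cycle
  relation-alternative = span-alternative rows
    (λ {u} u≡0 → comb-≡0 u (λ k → ζ ^ toℕ k) u≡0)
    (λ {u} {v} {w} q u≈0 v≈0 w≡ → begin
      eval w ζ
        ≈⟨ sum-cong-≋ {n} (λ k → *-congʳ (ι-cong (w≡ k))) ⟩
      comb (λ k → u k ℚ.+ q ℚ.* v k) (λ k → ζ ^ toℕ k)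
        ≈⟨ comb-+ u (λ k → q ℚ.* v k) (λ k → ζ ^ toℕ k) ⟩
      eval u ζ + comb (λ k → q ℚ.* v k) (λ k → ζ ^ toℕ k)
        ≈⟨ +-cong u≈0 (trans (comb-scale q v (λ k → ζ ^ toℕ k)) (trans (*-congˡ v≈0) (zeroʳ _))) ⟩
      0# + 0#                                                                     ≈⟨ +-identityʳ 0# ⟩
      0#                                                                          ∎)
    (Allₚ.map⁺ (All.universal row-relation ridge-indices))

  -- A cycle on copy j, extended by zero to the other copies, is a cycle on the whole.
  block-indep : ∀ {S S′} → (∀ x → S (from x) ≡ S′ x) → Indep Cycle S → SumIndep N ps S′
  block-indep {S} {S′} S≗S′ ind j c supp ∂c≡0 w = ≡.trans (≡.sym (z-encode w))
      (ind z z-supp (boundary-cycle {z} ∂z≡0) (encode (j , w)))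
    where
    z′ : Fin N × Facet ps → ℚ
    z′ (j′ , w) = if does (j′ Fin.≟ j) then c w else 0ℚ
    z : Fin n → ℚ
    z k = z′ (to k)
    z-encode : ∀ w → z (encode (j , w)) ≡ c w
    z-encode w = ≡.trans (≡.cong z′ (to-encode (j , w))) same
      where
      same : z′ (j , w) ≡ c w
      same with j Fin.≟ j
      ... | yes _ = ≡.refl
      ... | no j≢j = contradiction ≡.refl j≢j
    z′-other : ∀ {j′} w → j′ ≢ j → z′ (j′ , w) ≡ 0ℚ
    z′-other {j′} w j′≢j with j′ Fin.≟ j
    ... | yes j′≡j = contradiction j′≡j j′≢j
    ... | no _ = ≡.refl
    z-supp : ∀ k → S k ≡ false → z k ≡ 0ℚ
    z-supp k Sk = z′-supp (to k) (≡.trans (≡.sym (S≗S′ (to k))) (≡.trans (≡.cong S (strictlyInverseʳ k)) Sk))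
      where
      z′-supp : ∀ x → S′ x ≡ false → z′ x ≡ 0ℚ
      z′-supp (j′ , w) S′x with j′ Fin.≟ j
      ... | yes ≡.refl = supp w S′x
      ... | no _ = ≡.refl
    ∂z≡0 : ∀ j′ ρ → block-boundary z j′ ρ ≡ 0ℚ
    ∂z≡0 j′ ρ with j′ Fin.≟ j
    ... | yes ≡.refl = ≡.trans (≡.cong sumℚ
        (Listₚ.map-cong (λ w → ≡.cong (ℚ._* ∂ {ps = ps} w ρ) (z-encode w)) (allFacets ps))) (∂c≡0 ρ)
    ... | no j′≢j = ≡.trans (sumℚ-allFacets ps _) (ℚF.sumFacet-zero ps λ w →
            ≡.trans (≡.cong (ℚ._* ∂ {ps = ps} w ρ) (≡.trans (≡.cong z′ (to-encode (j′ , w))) (z′-other w j′≢j)))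
                (ℚₚ.*-zeroˡ (∂ {ps = ps} w ρ)))

  -- The value of a cycle at k is seen on the copy containing k, and the restriction to that copy is
  -- again a cycle.
  indep-block : ∀ {S S′} → (∀ k → S k ≡ S′ (to k)) → SumIndep N ps S′ → Indep Cycle S
  indep-block {S} {S′} S≗S′ ind z supp cycle k = ≡.trans
      (≡.cong z (≡.trans (≡.sym (strictlyInverseʳ k)) (encode↔-from (to k))))
    (ind (proj₁ (to k)) (λ w → z (encode (proj₁ (to k) , w)))
      (λ w S′w → supp _ (≡.trans (S≗S′ _) (≡.trans (≡.cong S′ (to-encode (proj₁ (to k) , w))) S′w)))
      (cycle-boundary {z} cycle (proj₁ (to k))) (proj₂ (to k)))

  sumFin≈eval : ∀ f → sumFin K n (λ k → ι (f k) * pow K ζ (toℕ k)) ≈ eval f ζ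
  sumFin≈eval f = trans (sumFin≈sum K n _) (sum-cong-≋ {n} (λ k → *-congˡ (pow≈^ K ζ (toℕ k))))

  cyc⇒indep : ∀ {S} → CycIndep K n ζ S → Indep Relation S
  cyc⇒indep ind f supp f≈0 = ind f supp (trans (sumFin≈eval f) f≈0)

  indep⇒cyc : ∀ {S} → Indep Relation S → CycIndep K n ζ S
  indep⇒cyc ind f supp f≈0 = ind f supp (trans (sym (sumFin≈eval f)) f≈0)

  dual : Dual {E = Fin n} {E' = Fin N × Facet ps} (CycIndep K n ζ) (SumIndep N ps)
  dual = encode↔ , λ B → mk⇔
    (λ (ind , maximal) → basis-transport {Ind = Indep Cycle} encode↔ block-indep indep-block
      (complement-basis relation⊥cycle relation-alternative
        (cyc⇒indep ind , λ S indS → maximal S (indep⇒cyc indS))))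
    (λ basis → let (ind , maximal) = complement-basis⁻ relation⊥cycle relation-alternative
                     (basis-transport⁻ {Ind = Indep Cycle} encode↔ block-indep indep-block {B = not ∘ B} basis)
               in indep⇒cyc ind , λ S indS → maximal S (cyc⇒indep indS))

theorem1p1 : ∀ {c ℓ} (K : ℚField c ℓ) (r : ℕ) → 1 ≤ r →
    (ps ms : Vec ℕ r) →
    (∀ i → Prime (lookup ps i)) →
    (∀ i j → lookup ps i ≡ lookup ps j → i ≡ j) →
    (∀ i → 1 ≤ lookup ms i) →
    (n : ℕ) → n ≡ prodℕ (powVec ps ms) →
    (ζ : ℚField.Carrier K) → IsPrimitiveRoot K n ζ →
    Dual {E = Fin n} {E' = Fin (prodℕ (powVecPred ps ms)) × Facet ps}
    (CycIndep K n ζ) (SumIndep (prodℕ (powVecPred ps ms)) ps)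
theorem1p1 K r _ ps ms primes distinct 1≤ms n n≡ ζ (ζ^n≈1 , ζ^≉1) with ≡.trans n≡ (prodℕ-powVec ps ms 1≤ms)
... | ≡.refl = Main.dual K ps primes distinct N prime-divisors {{n≢0}} ζ (trans (sym (pow≈^ K ζ n)) ζ^n≈1)
        (λ k 0<k k<n e → ζ^≉1 k 0<k k<n (trans (pow≈^ K ζ k) e))
  where
  open Over K
  N = prodℕ (powVecPred ps ms)
  prime-divisors : ∀ {q} → Prime q → q ℕᵈ.∣ n → ∃ λ i → q ≡ lookup ps i
  prime-divisors {q} q-prime q∣n with prime∣prodℕ⇒∃∣ q-prime (powVec ps ms) (≡.subst (q ℕᵈ.∣_) n≡ q∣n)
  ... | i , q∣ = i , prime∣prime⇒≡ q-prime (primes i)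
        (prime∣^⇒∣ q-prime (lookup ps i) (lookup ms i) (≡.subst (q ℕᵈ.∣_) (lookup-powVec ps ms i) q∣))
  n≢0 : NonZero n
  n≢0 = ≡.subst NonZero (≡.sym n≡) (powers≢0 ps ms primes)
    where
    powers≢0 : ∀ {r} (ps ms : Vec ℕ r) → (∀ i → Prime (lookup ps i)) → NonZero (prodℕ (powVec ps ms))
    powers≢0 [] [] _ = _
    powers≢0 (p ∷ ps) (m ∷ ms) primes = ℕₚ.m*n≢0 (p ℕ.^ m) _
      {{ℕₚ.m^n≢0 p m {{prime⇒nonZero (primes zero)}}}} {{powers≢0 ps ms (primes ∘ suc)}}
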